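{- Let $p$ be an odd prime, $m$ even, $M=\mathbb F_{p^m}$, $Q=p^{m/2}$, $1\le k\le m-1$, $q=p^k$, $r=p^{k+m/2}$, $e=\gcd(k,m)$ with $m/e$ odd, $d=\gcd(k+m/2,m)$, $\mathbb E=\mathbb F_{p^e}$, $\mathbb D=\mathbb F_{p^d}$, $B\in M$ a non-square, $A\in M$ with $AB\in\mathbb F_Q^\times$, and $\mathcal C$ as in the context. Let $(X,Y)\in\mathrm{Aut}(\mathcal C)$ with $X(x,y)=(f_1(x)+f_2(y),f_3(x)+f_4(y))$ and $Y(x,y)=(g_1(x)+g_2(y),g_3(x)+g_4(y))$, where $X$ is semilinear over $\mathbb D$, $Y$ is semilinear over $\mathbb E$, and $X$ is in diagonal form, i.e. $f_2=f_3=0$. Then $f_1,f_4,g_1,g_2,g_3,g_4$ are all monomials.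
   Context: $\mathcal C=\{R_{u,v}:u,v\in M\}$, where $R_{u,v}(x,y)=(x^qu+xu^q+B(y^qv+yv^q),\ x^rv+Axv^r+Ay^ru+yu^r)$. $\mathrm{Aut}(\mathcal C)$ is the set of pairs $(X,Y)$ of invertible $\mathbb F_p$-linear maps of $M\times M$ such that for every $(u,v)$ there is $(w,t)$ with $X\circ R_{u,v}=R_{w,t}\circ Y$. The $f_i,g_i$ are $\mathbb F_p$-linear maps $M\to M$. A map $Z$ is semilinear over a subfield $K\subseteq M$ if it is additive and there is an automorphism $\sigma$ of $K$ with $Z(\lambda\cdot z)=\sigma(\lambda)Z(z)$ for all $\lambda\in K$. A monomial is a map $x\mapsto ax^{p^j}$ with $a\in M$, $j\ge0$. -}

module Defs where

open import Level using (0ℓ)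
open import Data.Nat as ℕ using (ℕ; zero; suc)
open import Data.Fin using (Fin)
open import Data.Product using (Σ; ∃; ∃-syntax; _×_; _,_)
open import Relation.Nullary using (¬_)
open import Relation.Binary.PropositionalEquality using (_≡_)

import Algebra.Structures as AS
open import Function.Bundles using (_↔_)

-- A finite field with exactly `size` elements, equality is propositional.
-- (Every field with p^m elements is F_{p^m}, so this is F_{p^m} up to iso.)
record FiniteField (size : ℕ) : Set₁ where
  infixl 7 _*_
  infixl 6 _+_
  field
    Carrier : Set
    _+_ _*_ : Carrier → Carrier → Carrier
    -_      : Carrier → Carrier
    0# 1#   : Carrier
    isCommutativeRing : AS.IsCommutativeRing {A = Carrier} _≡_ _+_ _*_ -_ 0# 1#
    0≢1     : ¬ (0# ≡ 1#)
    inverse : ∀ x → ¬ (x ≡ 0#) → ∃[ y ] (x * y ≡ 1#)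
    card    : Carrier ↔ Fin size

module FieldNotions {size : ℕ} (F : FiniteField size) where
  open FiniteField F

  _^_ : Carrier → ℕ → Carrier
  x ^ zero  = 1#
  x ^ suc n = x * (x ^ n)

  -- the subfield F_{p^j} of M : elements fixed by x ↦ x^(p^j)
  InSub : ℕ → ℕ → Carrier → Set
  InSub p j λ' = λ' ^ (p ℕ.^ j) ≡ λ'

  IsSquare : Carrier → Set
  IsSquare z = ∃[ w ] (w * w ≡ z)

  Additive : (Carrier → Carrier) → Set
  Additive f = ∀ x y → f (x + y) ≡ f x + f y

  Pair : Set
  Pair = Carrier × Carrier

  _⊕_ : Pair → Pair → Pair
  (a , b) ⊕ (c , d) = (a + c , b + d)

  _•_ : Carrier → Pair → Pair
  λ' • (a , b) = (λ' * a , λ' * b)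

  -- F_p-linear = additive (in characteristic p, additivity gives F_p-linearity)
  IsFpLinear : (Pair → Pair) → Set
  IsFpLinear Z = ∀ a b → Z (a ⊕ b) ≡ Z a ⊕ Z b

  IsInvertible : (Pair → Pair) → Set
  IsInvertible Z = Σ (Pair → Pair) λ W → ((∀ a → W (Z a) ≡ a) × (∀ a → Z (W a) ≡ a))

  IsSubfieldAut : ℕ → ℕ → (Carrier → Carrier) → Set
  IsSubfieldAut p j σ =
    (∀ a → InSub p j a → InSub p j (σ a)) ×
    (∀ a b → InSub p j a → InSub p j b → σ (a + b) ≡ σ a + σ b) ×
    (∀ a b → InSub p j a → InSub p j b → σ (a * b) ≡ σ a * σ b) ×
    (∀ a b → InSub p j a → InSub p j b → σ a ≡ σ b → a ≡ b) ×
    (∀ b → InSub p j b → ∃[ a ] (InSub p j a × σ a ≡ b))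

  IsSemilinearOver : ℕ → ℕ → (Pair → Pair) → Set
  IsSemilinearOver p j Z =
    IsFpLinear Z ×
    Σ (Carrier → Carrier) λ σ → (IsSubfieldAut p j σ ×
            (∀ λ' z → InSub p j λ' → Z (λ' • z) ≡ σ λ' • Z z))

  IsMonomial : ℕ → (Carrier → Carrier) → Set
  IsMonomial p f = ∃[ a ] ∃[ j ] (∀ x → f x ≡ a * (x ^ (p ℕ.^ j)))

  R : (q r : ℕ) (A B : Carrier) → Carrier → Carrier → Pair → Pair
  R q r A B u v (x , y) =
    ( (x ^ q) * u + x * (u ^ q) + B * ((y ^ q) * v + y * (v ^ q))
    , (x ^ r) * v + A * x * (v ^ r) + A * (y ^ r) * u + y * (u ^ r) )

  InAut : (q r : ℕ) (A B : Carrier) → (Pair → Pair) → (Pair → Pair) → Set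
  InAut q r A B X Y =
    IsFpLinear X × IsInvertible X × IsFpLinear Y × IsInvertible Y ×
    (∀ u v → ∃[ w ] ∃[ t ] (∀ z → X (R q r A B u v z) ≡ R q r A B w t (Y z)))

  block : (f₁ f₂ f₃ f₄ : Carrier → Carrier) → Pair → Pair
  block f₁ f₂ f₃ f₄ (x , y) = (f₁ x + f₂ y , f₃ x + f₄ y)

{-# OPTIONS --safe #-}
module Submission where

-- Write x ⋆ u = x^q u + x u^q, a multiplication without zero divisors because m / e
-- is odd, and let (w , t) be the image of (u , v).  As f₂ = f₃ = 0, the first
-- components for (u , 0) and (0 , v) on either axis give four relations, two of which
-- are orthogonality relations such as g₁ x ⋆ w + B (g₃ x ⋆ t) = 0.  Eliminating w^q
-- from two instances shows that g₃ is a constant multiple of g₁ (or one of them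
-- vanishes), and likewise for g₂, g₄ and for the components of (u , v) ↦ (w , t).
-- The remaining two relations then read f (x ⋆ u) = α g(x)^q h(u) + β g(x) h(u)^q.
-- Symmetry in x and u makes h a multiple of g, so f (x ⋆ u) = γ (g x ⋆ g u).  For the
-- coefficients bᵢ of the linearized polynomial g this gives bᵢ₋ₖ bᵢ = 0, and then that
-- only one of them is nonzero, so g and f are monomials.  This treats f₁ and all gᵢ;
-- f₄ is recovered from the second component.

open import Defs
open import Algebra.Bundles using (CommutativeMonoid; CommutativeRing)
import Algebra.Properties.CommutativeMonoid.Sum as CMSum
import Algebra.Solver.Ring
open import Algebra.Solver.Ring.AlmostCommutativeRing using (fromCommutativeRing; _-Raw-AlmostCommutative⟶_)
open import Data.Empty using (⊥-elim)
open import Data.Fin as Fin using (Fin; toℕ)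
open import Data.Fin.Permutation using (permutation)
import Data.Fin.Properties as Fin
open import Data.Integer as ℤ using (ℤ; -[1+_])
import Data.Integer.Properties as ℤ
import Data.Maybe as Maybe
open import Data.Nat as ℕ using (ℕ; zero; suc; _≤_; _<_; _∸_; _%_; _/_; _!; s≤s; z≤n)
  renaming (_+_ to _+ℕ_; _*_ to _*ℕ_; _^_ to _^ℕ_)
open import Data.Nat.Combinatorics using (nCk≡n!/k![n-k]!; k![n∸k]!∣n!; nCn≡1) renaming (_C_ to _choose_)
open import Data.Nat.Coprimality using (coprime-Bézout; prime⇒coprime)
open import Data.Nat.Divisibility
  using (_∣_; _∤_; divides; divides-refl; ∣⇒≤; m∣m*n; ∣m∣n⇒∣m+n; ∣m+n∣m⇒∣n; ∣n⇒∣m*n; ∣-refl; m%n≡0⇒n∣m)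
import Data.Nat.DivMod as DM
open import Data.Nat.DivMod using (m≡m%n+[m/n]*n; m/n*n≡m; m%n<n)
open import Data.Nat.GCD using (gcd; gcd[m,n]∣m; module Bézout)
open import Data.Nat.Primality using (Prime; euclidsLemma; prime⇒nonZero; prime⇒nonTrivial)
import Data.Nat.Properties as ℕ
import Data.Nat.Solver
open import Data.Product using (∃-syntax; _×_; _,_; proj₁; proj₂)
import Data.Sign as Sign
open import Data.Sum using (_⊎_; inj₁; inj₂)
open import Data.Vec using (Vec; []; _∷_; replicate)
open import Function using (_∘_; _$_)
open import Function.Bundles using (Inverse)
open import Function.Definitions using (Injective)
open import Level using (0ℓ)
open import Relation.Binary.Definitions using (tri<; tri≈; tri>)
open import Relation.Binary.PropositionalEquality
open import Relation.Nullary using (¬_; Dec; yes; no)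
open import Relation.Nullary.Decidable using (map′; dec⇒maybe; ¬?; decidable-stable; _×-dec_)

-- Oddness of m / e enters through one fact: x ↦ x^q has odd order m / e > 1 on M. Hence no y ≠ 0
-- satisfies y^q = -y, and the second and fourth iterates of this map are still nontrivial, which
-- the independence of w, w^q, w^(q²) and the last step on the coefficients rely on. The obstacle
-- that shapes the proof is that (w , t) is only known to exist. The functions of u and v obtained
-- by choosing it come without additivity and without a known value at 0. What is proved about them
-- rests on counting (an injective map of a finite field is bijective) and on the relations
-- themselves; linear structure comes from the f's and g's. Each axis yields its own exponent. Both
-- axes compute f₁, once as f₁ z and once as f₁ (B z), and this forces the two exponents to give the
-- same map. Only then do g₁, g₃ and the image of (0 , v) share an exponent in the relation for f₄.

private module ℕS = Data.Nat.Solver.+-*-Solver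

-- Arithmetic in a finite field: ring solver, decidable equality, inverses, powers.

module Field {size : ℕ} (F : FiniteField size) where
  open FiniteField F public hiding (_+_; _*_; -_; 0#; 1#)
  open FieldNotions F public

  commutativeRing : CommutativeRing _ _
  commutativeRing = record { isCommutativeRing = isCommutativeRing }

  open CommutativeRing commutativeRing public
    using (_+_; _*_; -_; 0#; 1#; _-_; zeroˡ; zeroʳ; +-identityˡ; +-identityʳ;
           *-identityˡ; *-identityʳ; -‿inverseˡ; -‿inverseʳ;
           +-assoc; +-comm; *-assoc; *-comm; distribˡ; distribʳ;
           ring; semiring; commutativeSemiring;
           *-commutativeMonoid; +-commutativeMonoid)
  open import Algebra.Properties.Ring ring public
    using (-‿distribˡ-*; -‿distribʳ-*; -0#≈0#; -‿involutive; -‿+-comm; -1*x≈-x; +-cancelˡ; +-cancelʳ)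

  -- The ring solver wants coefficients on which equality computes. Mapping ℤ into the field
  -- provides them, so numerals and cancellations are normalised over ℤ.
  module IntegerCoefficients where
    open import Algebra.Properties.Semiring.Mult.TCOptimised semiring
      using (1+×; ×-homo-+; ×1-homo-*) renaming (_×_ to _·_)

    ⟦_⟧ : ℤ → Carrier
    ⟦ ℤ.+ n ⟧ = n · 1#
    ⟦ -[1+ n ] ⟧ = - (suc n · 1#)

    ⟦⊖⟧ : ∀ m n → ⟦ m ℤ.⊖ n ⟧ ≡ m · 1# + - (n · 1#)
    ⟦⊖⟧ zero zero = sym (trans (+-identityˡ _) -0#≈0#)
    ⟦⊖⟧ zero (suc n) = sym (+-identityˡ _)
    ⟦⊖⟧ (suc m) zero = sym (trans (cong (suc m · 1# +_) -0#≈0#) (+-identityʳ _))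
    ⟦⊖⟧ (suc m) (suc n) = begin
      ⟦ suc m ℤ.⊖ suc n ⟧             ≡⟨ cong ⟦_⟧ (ℤ.[1+m]⊖[1+n]≡m⊖n m n) ⟩
      ⟦ m ℤ.⊖ n ⟧                     ≡⟨ ⟦⊖⟧ m n ⟩
      m · 1# - n · 1#                 ≡⟨ cong (_- n · 1#) (+-identityʳ (m · 1#)) ⟨
      m · 1# + 0# - n · 1#            ≡⟨ cong (λ z → m · 1# + z - n · 1#) (-‿inverseʳ 1#) ⟨
      m · 1# + (1# - 1#) - n · 1#     ≡⟨ cong (_- n · 1#) (trans (sym (+-assoc _ _ _)) (cong (_- 1#) (+-comm _ _))) ⟩
      1# + m · 1# - 1# - n · 1#       ≡⟨ +-assoc _ _ _ ⟩
      1# + m · 1# + (- 1# - n · 1#)   ≡⟨ cong (1# + m · 1# +_) (-‿+-comm 1# (n · 1#)) ⟩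
      1# + m · 1# - (1# + n · 1#)     ≡⟨ cong₂ _-_ (1+× m 1#) (1+× n 1#) ⟨
      suc m · 1# - suc n · 1#         ∎
      where open ≡-Reasoning

    +-homo : ∀ i j → ⟦ i ℤ.+ j ⟧ ≡ ⟦ i ⟧ + ⟦ j ⟧
    +-homo (ℤ.+ m) (ℤ.+ n) = ×-homo-+ 1# m n
    +-homo (ℤ.+ m) -[1+ n ] = ⟦⊖⟧ m (suc n)
    +-homo -[1+ m ] (ℤ.+ n) = trans (⟦⊖⟧ n (suc m)) (+-comm _ _)
    +-homo -[1+ m ] -[1+ n ] = trans
      (cong -_ (trans (cong (λ z → suc z · 1#) (sym (ℕ.+-suc m n))) (×-homo-+ 1# (suc m) (suc n))))
      (sym (-‿+-comm _ _))

    -‿homo : ∀ i → ⟦ ℤ.- i ⟧ ≡ - ⟦ i ⟧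
    -‿homo (ℤ.+ zero) = sym -0#≈0#
    -‿homo (ℤ.+ suc n) = refl
    -‿homo -[1+ n ] = sym (-‿involutive _)

    ⟦-◃⟧ : ∀ n → ⟦ Sign.- ℤ.◃ n ⟧ ≡ - (n · 1#)
    ⟦-◃⟧ zero = sym -0#≈0#
    ⟦-◃⟧ (suc n) = refl

    *-homo : ∀ i j → ⟦ i ℤ.* j ⟧ ≡ ⟦ i ⟧ * ⟦ j ⟧
    *-homo (ℤ.+ m) (ℤ.+ n) = trans (cong ⟦_⟧ (ℤ.+◃n≡+n (m *ℕ n))) (×1-homo-* m n)
    *-homo (ℤ.+ m) -[1+ n ] = trans (⟦-◃⟧ (m *ℕ suc n))
      (trans (cong -_ (×1-homo-* m (suc n))) (-‿distribʳ-* _ _))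
    *-homo -[1+ m ] (ℤ.+ n) = trans (⟦-◃⟧ (suc m *ℕ n))
      (trans (cong -_ (×1-homo-* (suc m) n)) (-‿distribˡ-* _ _))
    *-homo -[1+ m ] -[1+ n ] = trans (×1-homo-* (suc m) (suc n)) $
      trans (sym (-‿involutive _))
        (trans (cong -_ (-‿distribˡ-* _ _)) (-‿distribʳ-* _ _))

    homomorphism : ℤ.+-*-rawRing -Raw-AlmostCommutative⟶ fromCommutativeRing commutativeRing
    homomorphism = record
      { ⟦_⟧ = ⟦_⟧ ; +-homo = +-homo ; *-homo = *-homo ; -‿homo = -‿homo
      ; 0-homo = refl ; 1-homo = refl }

  open Algebra.Solver.Ring ℤ.+-*-rawRing (fromCommutativeRing commutativeRing)
    IntegerCoefficients.homomorphism
    (λ i j → Maybe.map (cong IntegerCoefficients.⟦_⟧) (dec⇒maybe (i ℤ.≟ j))) public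
    using (solve; _:=_; _:+_; _:*_; _:-_; :-_; con)

  open import Algebra.Properties.Semiring.Mult semiring public
    using (×-homo-+; ×1-homo-*; ×-assoc-*) renaming (_×_ to _·_)

  open Inverse card public using () renaming (to to index; from to elem)

  elem-index : ∀ x → elem (index x) ≡ x
  elem-index x = Inverse.strictlyInverseʳ card x

  index-elem : ∀ i → index (elem i) ≡ i
  index-elem i = Inverse.strictlyInverseˡ card i

  index-injective : ∀ {x y} → index x ≡ index y → x ≡ y
  index-injective {x} {y} e = trans (sym (elem-index x)) (trans (cong elem e) (elem-index y))

  elem-injective : ∀ {i j} → elem i ≡ elem j → i ≡ j
  elem-injective {i} {j} e = trans (sym (index-elem i)) (trans (cong index e) (index-elem j))

  infix 4 _≟_
  _≟_ : (x y : Carrier) → Dec (x ≡ y)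
  x ≟ y = map′ index-injective (cong index) (index x Fin.≟ index y)

  -- A missed value `y` together with the `size` many values of `f` would inject `Fin (suc size)`
  -- into `Fin size`.
  injective⇒surjective : (f : Carrier → Carrier) → Injective _≡_ _≡_ f →
                         ∀ y → ∃[ x ] f x ≡ y
  injective⇒surjective f f-inj y with Fin.any? (λ i → f (elem i) ≟ y)
  ... | yes (i , e) = elem i , e
  ... | no ¬e = ⊥-elim (ℕ.1+n≰n (Fin.injective⇒≤ {f = g} g-inj))
    where
    g : Fin (suc size) → Fin size
    g Fin.zero = index y
    g (Fin.suc i) = index (f (elem i))
    g-inj : Injective _≡_ _≡_ g
    g-inj {Fin.zero} {Fin.zero} _ = refl
    g-inj {Fin.zero} {Fin.suc j} e = ⊥-elim (¬e (j , sym (index-injective e)))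
    g-inj {Fin.suc i} {Fin.zero} e = ⊥-elim (¬e (i , index-injective e))
    g-inj {Fin.suc i} {Fin.suc j} e = cong Fin.suc (elem-injective (f-inj (index-injective e)))

  search : {P : Carrier → Set} → (∀ x → Dec (P x)) → Dec (∃[ x ] P x)
  search {P} P? = map′ (λ (i , p) → elem i , p)
    (λ (x , p) → index x , subst P (sym (elem-index x)) p) (Fin.any? (P? ∘ elem))

  infix 21 _⁻¹
  abstract
    -- Totalised so that inverses can be written without carrying a proof; the value at 0 is a
    -- placeholder, and `abstract` keeps the equality test from unfolding.
    _⁻¹ : Carrier → Carrier
    x ⁻¹ with x ≟ 0#
    ... | yes _ = 0#
    ... | no x≢0 = proj₁ (inverse x x≢0)

    ⁻¹-inverseʳ : ∀ {x} → ¬ x ≡ 0# → x * x ⁻¹ ≡ 1#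
    ⁻¹-inverseʳ {x} x≢0 with x ≟ 0#
    ... | yes x≡0 = ⊥-elim (x≢0 x≡0)
    ... | no _ = proj₂ (inverse x _)

  nonsquare⇒≢0 : ∀ {z} → ¬ IsSquare z → ¬ z ≡ 0#
  nonsquare⇒≢0 nonsquare refl = nonsquare (0# , zeroˡ 0#)

  ⁻¹-inverseˡ : ∀ {x} → ¬ x ≡ 0# → x ⁻¹ * x ≡ 1#
  ⁻¹-inverseˡ x≢0 = trans (*-comm _ _) (⁻¹-inverseʳ x≢0)

  *-cancelˡ : ∀ {a x y} → ¬ a ≡ 0# → a * x ≡ a * y → x ≡ y
  *-cancelˡ {a} {x} {y} a≢0 e = begin
    x             ≡⟨ *-identityˡ x ⟨
    1# * x        ≡⟨ cong (_* x) (⁻¹-inverseˡ a≢0) ⟨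
    a ⁻¹ * a * x  ≡⟨ *-assoc _ _ _ ⟩
    a ⁻¹ * (a * x) ≡⟨ cong (a ⁻¹ *_) e ⟩
    a ⁻¹ * (a * y) ≡⟨ *-assoc _ _ _ ⟨
    a ⁻¹ * a * y  ≡⟨ cong (_* y) (⁻¹-inverseˡ a≢0) ⟩
    1# * y        ≡⟨ *-identityˡ y ⟩
    y             ∎
    where open ≡-Reasoning

  integral : ∀ {a x} → ¬ a ≡ 0# → a * x ≡ 0# → x ≡ 0#
  integral a≢0 e = *-cancelˡ a≢0 (trans e (sym (zeroʳ _)))

  *-nonzero : ∀ {x y} → ¬ x ≡ 0# → ¬ y ≡ 0# → ¬ x * y ≡ 0#
  *-nonzero x≢0 y≢0 e = y≢0 (integral x≢0 e)

  x-y≡0⇒x≡y : ∀ {x y} → x - y ≡ 0# → x ≡ y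
  x-y≡0⇒x≡y {x} {y} e = begin
    x           ≡⟨ solve 2 (λ x y → x := x :- y :+ y) refl x y ⟩
    x - y + y   ≡⟨ cong (_+ y) e ⟩
    0# + y      ≡⟨ +-identityˡ y ⟩
    y           ∎
    where open ≡-Reasoning

  x≡y⇒x-y≡0 : ∀ {x y} → x ≡ y → x - y ≡ 0#
  x≡y⇒x-y≡0 refl = -‿inverseʳ _

  additive-0 : ∀ {f} → Additive f → f 0# ≡ 0#
  additive-0 {f} f-add = x-y≡0⇒x≡y (trans (solve 1 (λ a → a :- con (ℤ.+ 0) := a :+ a :- a) refl (f 0#))
    (x≡y⇒x-y≡0 (trans (sym (f-add 0# 0#)) (cong f (+-identityˡ 0#)))))

  additive-neg : ∀ {f} → Additive f → ∀ x → f (- x) ≡ - f x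
  additive-neg {f} f-add x = x-y≡0⇒x≡y (trans
    (solve 2 (λ a b → a :- (:- b) := a :+ b) refl (f (- x)) (f x))
    (trans (sym (f-add _ _)) (trans (cong f (-‿inverseˡ x)) (additive-0 f-add))))

  additive-minus : ∀ {f} → Additive f → ∀ x y → f (x - y) ≡ f x - f y
  additive-minus {f} f-add x y = trans (f-add x (- y)) (cong (f x +_) (additive-neg f-add y))

  additive-· : ∀ {f} → Additive f → ∀ n x → f (n · x) ≡ n · f x
  additive-· f-add zero x = additive-0 f-add
  additive-· {f} f-add (suc n) x = trans (f-add _ _) (cong (f x +_) (additive-· f-add n x))

  additive-injective : ∀ {f} → Additive f → (∀ x → f x ≡ 0# → x ≡ 0#) → Injective _≡_ _≡_ f
  additive-injective f-add ker e =
    x-y≡0⇒x≡y (ker _ (trans (additive-minus f-add _ _) (x≡y⇒x-y≡0 e)))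

  private module Exp where
    open import Algebra.Properties.Semiring.Exp semiring public
    open import Algebra.Properties.CommutativeSemiring.Exp commutativeSemiring public
      using (^-distrib-*)

  ^≡Exp : ∀ x n → x ^ n ≡ x Exp.^ n
  ^≡Exp x zero = refl
  ^≡Exp x (suc n) = cong (x *_) (^≡Exp x n)

  ^-distribˡ-+-* : ∀ x m n → x ^ (m +ℕ n) ≡ x ^ m * x ^ n
  ^-distribˡ-+-* x m n rewrite ^≡Exp x (m +ℕ n) | ^≡Exp x m | ^≡Exp x n = Exp.^-homo-* x m n

  ^-assocʳ : ∀ x m n → (x ^ m) ^ n ≡ x ^ (m *ℕ n)
  ^-assocʳ x m n rewrite ^≡Exp (x ^ m) n | ^≡Exp x m | ^≡Exp x (m *ℕ n) = Exp.^-assocʳ x m n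

  ^-distribʳ-* : ∀ x y n → (x * y) ^ n ≡ x ^ n * y ^ n
  ^-distribʳ-* x y n rewrite ^≡Exp (x * y) n | ^≡Exp x n | ^≡Exp y n = Exp.^-distrib-* x y n

  ^-zeroˡ : ∀ n → 1# ^ n ≡ 1#
  ^-zeroˡ zero = refl
  ^-zeroˡ (suc n) = trans (*-identityˡ _) (^-zeroˡ n)

  ^-identityʳ : ∀ x → x ^ 1 ≡ x
  ^-identityʳ = *-identityʳ

  ^≡0⇒≡0 : ∀ x n → x ^ n ≡ 0# → x ≡ 0#
  ^≡0⇒≡0 x zero e = ⊥-elim (0≢1 (sym e))
  ^≡0⇒≡0 x (suc n) e with x ≟ 0#
  ... | yes x≡0 = x≡0
  ... | no x≢0 = ⊥-elim (*-nonzero x≢0 (x≢0 ∘ ^≡0⇒≡0 x n) e)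

  -- Roots of polynomials

  -- A vector of coefficients, constant term first, stands for a monic
  -- polynomial of degree its length: the leading coefficient 1 is left out.
  eval : ∀ {n} → Vec Carrier n → Carrier → Carrier
  eval [] x = 1#
  eval (c ∷ cs) x = c + x * eval cs x

  -- Synthetic division by x - a; the remainder is the value at a.
  quotient : ∀ {n} → Carrier → Vec Carrier (suc n) → Vec Carrier n
  quotient a (c ∷ []) = []
  quotient a (c ∷ cs@(_ ∷ _)) = eval cs a ∷ quotient a cs

  eval-quotient : ∀ {n} a (cs : Vec Carrier (suc n)) x →
                  eval cs x ≡ (x - a) * eval (quotient a cs) x + eval cs a
  eval-quotient a (c ∷ []) x =
    solve 3 (λ a c x → c :+ x :* con (ℤ.+ 1) := (x :- a) :* con (ℤ.+ 1) :+ (c :+ a :* con (ℤ.+ 1)))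
      refl a c x
  eval-quotient a (c ∷ cs@(_ ∷ _)) x rewrite eval-quotient a cs x =
    solve 5 (λ a c x q e → c :+ x :* ((x :- a) :* q :+ e) := (x :- a) :* (e :+ x :* q) :+ (c :+ a :* e))
      refl a c x (eval (quotient a cs) x) (eval cs a)

  -- Induction on the degree: after division by x - a for the first root a, the other roots remain
  -- roots of the quotient, because their differences with a are nonzero.
  too-many-roots : ∀ {n} (cs : Vec Carrier n) (root : Fin (suc n) → Carrier) →
                   Injective _≡_ _≡_ root → ¬ (∀ i → eval cs (root i) ≡ 0#)
  too-many-roots [] root _ zeros = 0≢1 (sym (zeros Fin.zero))
  too-many-roots cs@(_ ∷ _) root root-inj zeros =
    too-many-roots (quotient (root Fin.zero) cs) (root ∘ Fin.suc) (Fin.suc-injective ∘ root-inj)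
      (λ i → integral (root-suc≢root-zero i) (begin
        (root (Fin.suc i) - a) * eval (quotient a cs) (root (Fin.suc i))
          ≡⟨ +-identityʳ _ ⟨
        (root (Fin.suc i) - a) * eval (quotient a cs) (root (Fin.suc i)) + 0#
          ≡⟨ cong ((root (Fin.suc i) - a) * eval (quotient a cs) (root (Fin.suc i)) +_) (zeros Fin.zero) ⟨
        (root (Fin.suc i) - a) * eval (quotient a cs) (root (Fin.suc i)) + eval cs a
          ≡⟨ eval-quotient a cs (root (Fin.suc i)) ⟨
        eval cs (root (Fin.suc i))
          ≡⟨ zeros (Fin.suc i) ⟩
        0# ∎))
    where
    open ≡-Reasoning
    a = root Fin.zero
    root-suc≢root-zero : ∀ i → ¬ root (Fin.suc i) - root Fin.zero ≡ 0#
    root-suc≢root-zero i e = Fin.0≢1+n (sym (root-inj (x-y≡0⇒x≡y e)))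

  -- Exponents start at 2 because x^n - x is monic of degree n only from there on.
  xⁿ⁺²-x : ∀ n → Vec Carrier (suc (suc n))
  xⁿ⁺²-x n = 0# ∷ (- 1#) ∷ replicate n 0#

  eval-xⁿ⁺²-x : ∀ n x → eval (xⁿ⁺²-x n) x ≡ x ^ suc (suc n) - x
  eval-xⁿ⁺²-x n x = trans
    (solve 2 (λ x y → con (ℤ.+ 0) :+ x :* (:- con (ℤ.+ 1) :+ x :* y) := x :* (x :* y) :- x) refl x
      (eval (replicate n 0#) x))
    (cong (λ y → x * (x * y) - x) (eval-replicate n))
    where
    eval-replicate : ∀ n → eval (replicate n 0#) x ≡ x ^ n
    eval-replicate zero = refl
    eval-replicate (suc n) = trans (+-identityˡ _) (cong (x *_) (eval-replicate n))

  fixed-points-bound : ∀ {n N} → 2 ≤ n → n < N → (root : Fin N → Carrier) →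
                       Injective _≡_ _≡_ root → ¬ (∀ i → root i ^ n ≡ root i)
  fixed-points-bound {suc zero} (s≤s ())
  fixed-points-bound {suc (suc n)} 2≤n n<N root root-inj fixed =
    too-many-roots (xⁿ⁺²-x n) (λ i → root (Fin.inject≤ i n<N))
      (Fin.inject≤-injective n<N n<N _ _ ∘ root-inj)
      (λ i → trans (eval-xⁿ⁺²-x n _) (x≡y⇒x-y≡0 (fixed _)))

  -- Sums and products over the whole field, and x^size = x.

  module _ (M : CommutativeMonoid 0ℓ 0ℓ) where
    open CommutativeMonoid M using (_≈_) renaming (Carrier to A)
    open CMSum M using (sum; sum-permute; sum-cong-≋)

    ∑-all : (Carrier → A) → A
    ∑-all g = sum (g ∘ elem)

    ∑-all-reindex : (g : Carrier → A) (f f⁻¹ : Carrier → Carrier) →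
                    (∀ x → f (f⁻¹ x) ≡ x) → (∀ x → f⁻¹ (f x) ≡ x) → ∑-all g ≈ ∑-all (g ∘ f)
    ∑-all-reindex g f f⁻¹ ff⁻¹ f⁻¹f = CommutativeMonoid.trans M
      (sum-permute (g ∘ elem) (permutation (index ∘ f ∘ elem) (index ∘ f⁻¹ ∘ elem)
        (λ i → trans (cong (index ∘ f) (elem-index _)) (trans (cong index (ff⁻¹ _)) (index-elem i)))
        (λ i → trans (cong (index ∘ f⁻¹) (elem-index _)) (trans (cong index (f⁻¹f _)) (index-elem i)))))
      (sum-cong-≋ (λ i → CommutativeMonoid.reflexive M (cong g (elem-index (f (elem i))))))

  -- Translation by 1 permutes the field, so the sum of all elements is unchanged when `size` copies
  -- of 1 are added to it.
  size·1≡0 : size · 1# ≡ 0#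
  size·1≡0 = begin
    size · 1#                     ≡⟨ sum-replicate size ⟨
    sum {size} (λ _ → 1#)         ≡⟨ solve 2 (λ s t → t := s :+ t :- s) refl (sum elem) (sum {size} (λ _ → 1#)) ⟩
    sum elem + sum {size} (λ _ → 1#) - sum elem
                                  ≡⟨ cong (_- sum elem) (∑-distrib-+ elem (λ _ → 1#)) ⟨
    sum (λ i → elem i + 1#) - sum elem
                                  ≡⟨ x≡y⇒x-y≡0 (sym (∑-all-reindex +-commutativeMonoid (λ x → x) (_+ 1#) (_- 1#)
                                       (solve 1 (λ x → x :- con (ℤ.+ 1) :+ con (ℤ.+ 1) := x) refl)
                                       (solve 1 (λ x → x :+ con (ℤ.+ 1) :- con (ℤ.+ 1) := x) refl))) ⟩
    0#                            ∎
    where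
    open ≡-Reasoning
    open CMSum +-commutativeMonoid

  -- Multiplication by y permutes the nonzero elements.  To take products over the
  -- whole field, unit₀ replaces 0 by 1, and the resulting defect y at the element 0
  -- is collected by if₀ y 1#.
  module _ where
    open CMSum *-commutativeMonoid
      renaming (sum to prod; ∑-distrib-+ to ∏-distrib-*; sum-replicate to prod-replicate;
                sum-cong-≗ to prod-cong; sum-remove to prod-remove; sum-replicate-zero to prod-replicate-one)
    private
      if₀ : Carrier → Carrier → Carrier → Carrier
      if₀ a b x with x ≟ 0#
      ... | yes _ = a
      ... | no _ = b

      if₀-yes : ∀ {a b x} → x ≡ 0# → if₀ a b x ≡ a
      if₀-yes {x = x} e with x ≟ 0#
      ... | yes _ = refl
      ... | no ¬e = ⊥-elim (¬e e)

      if₀-no : ∀ {a b x} → ¬ x ≡ 0# → if₀ a b x ≡ b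
      if₀-no {x = x} ¬e with x ≟ 0#
      ... | yes e = ⊥-elim (¬e e)
      ... | no _ = refl

      unit₀ : Carrier → Carrier
      unit₀ x = if₀ 1# x x

    ∏ : (Carrier → Carrier) → Carrier
    ∏ = ∑-all *-commutativeMonoid

    prod-nonzero : ∀ {n} (t : Fin n → Carrier) → (∀ i → ¬ t i ≡ 0#) → ¬ prod t ≡ 0#
    prod-nonzero {zero} t nz = 0≢1 ∘ sym
    prod-nonzero {suc n} t nz = *-nonzero (nz Fin.zero) (prod-nonzero (t ∘ Fin.suc) (nz ∘ Fin.suc))

    prod-if₀ : ∀ {n} (t : Fin n → Carrier) i y → t i ≡ 0# → Injective _≡_ _≡_ t →
               prod (λ j → if₀ y 1# (t j)) ≡ y
    prod-if₀ {suc n} t i y e t-inj = begin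
      prod (λ j → if₀ y 1# (t j))
        ≡⟨ prod-remove {i = i} (λ j → if₀ y 1# (t j)) ⟩
      if₀ y 1# (t i) * prod (λ j → if₀ y 1# (t (Fin.punchIn i j)))
        ≡⟨ cong₂ _*_ (if₀-yes e) (trans
             (prod-cong (λ j → if₀-no (λ e′ → Fin.punchInᵢ≢i i j (t-inj (trans e′ (sym e))))))
             (prod-replicate-one n)) ⟩
      y * 1#
        ≡⟨ *-identityʳ y ⟩
      y ∎
      where open ≡-Reasoning

    x^size≡x : ∀ y → y ^ size ≡ y
    x^size≡x y with y ≟ 0#
    ... | yes refl = zero-power size (index 0#)
      where
      zero-power : ∀ n → Fin n → 0# ^ n ≡ 0#
      zero-power (suc n) _ = zeroˡ _
    ... | no y≢0 = *-cancelˡ ∏≢0 (begin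
      ∏ unit₀ * y ^ size
        ≡⟨ cong (∏ unit₀ *_) (trans (^≡Exp y size) (sym (prod-replicate size))) ⟩
      ∏ unit₀ * prod {size} (λ _ → y)
        ≡⟨ ∏-distrib-* (unit₀ ∘ elem) (λ _ → y) ⟨
      ∏ (λ x → unit₀ x * y)
        ≡⟨ prod-cong {size} (λ i → split (elem i)) ⟩
      ∏ (λ x → unit₀ (y * x) * if₀ y 1# x)
        ≡⟨ ∏-distrib-* (λ i → unit₀ (y * elem i)) _ ⟩
      ∏ (λ x → unit₀ (y * x)) * ∏ (if₀ y 1#)
        ≡⟨ cong₂ _*_
             (∑-all-reindex *-commutativeMonoid unit₀ (y *_) (y ⁻¹ *_)
               (λ x → trans (sym (*-assoc _ _ _)) (trans (cong (_* x) (⁻¹-inverseʳ y≢0)) (*-identityˡ x)))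
               (λ x → trans (sym (*-assoc _ _ _)) (trans (cong (_* x) (⁻¹-inverseˡ y≢0)) (*-identityˡ x))))
             (sym (prod-if₀ elem (index 0#) y (elem-index 0#) elem-injective)) ⟨
      ∏ unit₀ * y ∎)
      where
      open ≡-Reasoning
      ∏≢0 : ¬ ∏ unit₀ ≡ 0#
      ∏≢0 = prod-nonzero (unit₀ ∘ elem) (λ i e → unit₀-nonzero (elem i) e)
        where
        unit₀-nonzero : ∀ x → ¬ unit₀ x ≡ 0#
        unit₀-nonzero x with x ≟ 0#
        ... | yes _ = 0≢1 ∘ sym
        ... | no x≢0 = x≢0
      split : ∀ x → unit₀ x * y ≡ unit₀ (y * x) * if₀ y 1# x
      split x with x ≟ 0#
      ... | yes refl = trans (cong (_* y) (sym (if₀-yes (zeroʳ y)))) refl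
      ... | no x≢0 = trans (*-comm x y)
        (trans (sym (if₀-no (*-nonzero y≢0 x≢0))) (sym (*-identityʳ _)))

-- Binomial coefficients modulo a prime.

module _ {p : ℕ} (p-prime : Prime p) where
  private instance
    p-nonZero = prime⇒nonZero p-prime
    p-nonTrivial = prime⇒nonTrivial p-prime

  prime∤! : ∀ j → j < p → p ∤ j !
  prime∤! zero _ p∣1 = ℕ.<⇒≱ (ℕ.nonTrivial⇒n>1 p) (∣⇒≤ p∣1)
  prime∤! (suc j) j<p p∣ with euclidsLemma (suc j) (j !) p-prime p∣
  ... | inj₁ p∣j = ℕ.<⇒≱ j<p (∣⇒≤ p∣j)
  ... | inj₂ p∣j! = prime∤! j (ℕ.<⇒≤ j<p) p∣j!

  -- The prime divides p! = C(p,j) · j! · (p-j)!, but neither of the two factorials.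
  prime∣C : ∀ j → 0 < j → j < p → p ∣ p choose j
  prime∣C j 0<j j<p with euclidsLemma (p choose j) (j ! *ℕ (p ∸ j) !) p-prime p∣C*
    where
    instance _ = j ℕ.!* (p ∸ j) !≢0
    p! : (p choose j) *ℕ (j ! *ℕ (p ∸ j) !) ≡ p !
    p! = trans (cong (_*ℕ (j ! *ℕ (p ∸ j) !)) (nCk≡n!/k![n-k]! (ℕ.<⇒≤ j<p))) (m/n*n≡m (k![n∸k]!∣n! (ℕ.<⇒≤ j<p)))
    p∣p! : ∀ {n} .{{_ : ℕ.NonZero n}} → n ∣ n !
    p∣p! {suc n} = m∣m*n (n !)
    p∣C* : p ∣ (p choose j) *ℕ (j ! *ℕ (p ∸ j) !)
    p∣C* = subst (p ∣_) (sym p!) p∣p!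
  ... | inj₁ p∣C = p∣C
  ... | inj₂ p∣* with euclidsLemma (j !) ((p ∸ j) !) p-prime p∣*
  ...   | inj₁ p∣j! = ⊥-elim (prime∤! j j<p p∣j!)
  ...   | inj₂ p∣p-j! = ⊥-elim (prime∤! (p ∸ j) (ℕ.∸-monoʳ-< {p} 0<j (ℕ.<⇒≤ j<p)) p∣p-j!)

-- Characteristic p and the powers `φ i` of the Frobenius map.

module Frobenius (p m : ℕ) (p-prime : Prime p) (p-odd : p % 2 ≡ 1) (0<m : 0 < m)
                 (F : FiniteField (p ^ℕ m)) where
  open Field F public
  private instance
    p-nonZero = prime⇒nonZero p-prime
    p-nonTrivial = prime⇒nonTrivial p-prime
    m-nonZero = ℕ.>-nonZero 0<m

  -- The m-th power of p · 1 is `size` · 1 = 0, and a field has no nilpotents.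
  p·1≡0 : p · 1# ≡ 0#
  p·1≡0 = ^≡0⇒≡0 (p · 1#) m (trans (sym (^·1 m)) size·1≡0)
    where
    ^·1 : ∀ n → (p ^ℕ n) · 1# ≡ (p · 1#) ^ n
    ^·1 zero = +-identityʳ 1#
    ^·1 (suc n) = trans (×1-homo-* p (p ^ℕ n)) (cong ((p · 1#) *_) (^·1 n))

  p∣n⇒n·x≡0 : ∀ {n} x → p ∣ n → n · x ≡ 0#
  p∣n⇒n·x≡0 x (divides-refl c) = begin
    (c *ℕ p) · x         ≡⟨ cong ((c *ℕ p) ·_) (*-identityˡ x) ⟨
    (c *ℕ p) · (1# * x)  ≡⟨ ×-assoc-* (c *ℕ p) 1# x ⟨
    (c *ℕ p) · 1# * x    ≡⟨ cong (_* x) (trans (×1-homo-* c p) (trans (cong (c · 1# *_) p·1≡0) (zeroʳ _))) ⟩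
    0# * x               ≡⟨ zeroˡ x ⟩
    0#                   ∎
    where open ≡-Reasoning

  -- Writing p = 1 + 2c, one has x = x + c (x + x) = p x = 0.
  x+x≡0⇒x≡0 : ∀ {x} → x + x ≡ 0# → x ≡ 0#
  x+x≡0⇒x≡0 {x} e = begin
    x                                   ≡⟨ +-identityʳ x ⟨
    1 · x                               ≡⟨ +-identityʳ _ ⟨
    1 · x + 0#                          ≡⟨ cong (1 · x +_) (even (p / 2)) ⟨
    1 · x + (p / 2 *ℕ 2) · x            ≡⟨ ×-homo-+ x 1 (p / 2 *ℕ 2) ⟨
    (1 +ℕ p / 2 *ℕ 2) · x               ≡⟨ cong (λ r → (r +ℕ p / 2 *ℕ 2) · x) p-odd ⟨
    (p % 2 +ℕ p / 2 *ℕ 2) · x           ≡⟨ cong (_· x) (m≡m%n+[m/n]*n p 2) ⟨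
    p · x                               ≡⟨ p∣n⇒n·x≡0 x ∣-refl ⟩
    0#                                  ∎
    where
    open ≡-Reasoning
    even : ∀ c → (c *ℕ 2) · x ≡ 0#
    even zero = refl
    even (suc c) = trans (sym (+-assoc x x _)) (trans (cong₂ _+_ e (even c)) (+-identityˡ 0#))

  module _ where
    open CMSum +-commutativeMonoid
    open import Algebra.Properties.CommutativeSemiring.Binomial commutativeSemiring

    sum-ends : ∀ {n} (t : Fin (suc (suc n)) → Carrier) →
               (∀ i → 0 < toℕ i → toℕ i < suc n → t i ≡ 0#) → sum t ≡ t Fin.zero + t (Fin.fromℕ (suc n))
    sum-ends {n} t mid = cong (t Fin.zero +_) (begin
      sum (t ∘ Fin.suc)                                 ≡⟨ sum-init-last (t ∘ Fin.suc) ⟩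
      sum (λ i → t (Fin.suc (Fin.inject₁ i))) + t (Fin.fromℕ (suc n))
        ≡⟨ cong (_+ t (Fin.fromℕ (suc n))) (trans (sum-cong-≗ {n} (λ i →
             mid (Fin.suc (Fin.inject₁ i)) (s≤s z≤n) (s≤s (subst (_< n) (sym (Fin.toℕ-inject₁ i)) (Fin.toℕ<n i)))))
             (sum-replicate-zero n)) ⟩
      0# + t (Fin.fromℕ (suc n))                        ≡⟨ +-identityˡ _ ⟩
      t (Fin.fromℕ (suc n))                             ∎)
      where open ≡-Reasoning

    ^p-distrib-+ : ∀ x y → (x + y) ^ p ≡ x ^ p + y ^ p
    ^p-distrib-+ x y = go p refl
      where
      open ≡-Reasoning
      go : ∀ n → n ≡ p → (x + y) ^ n ≡ x ^ n + y ^ n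
      go zero refl = ⊥-elim (ℕ.<⇒≱ (ℕ.nonTrivial⇒n>1 p) z≤n)
      go n@(suc n-1) refl = begin
        (x + y) ^ n                       ≡⟨ ^≡Exp (x + y) n ⟩
        _                                 ≡⟨ theorem n x y ⟩
        sum (binomialTerm x y n)          ≡⟨ sum-ends (binomialTerm x y n) (λ i 0<i i<n → p∣n⇒n·x≡0 _ (prime∣C p-prime (toℕ i) 0<i i<n)) ⟩
        binomialTerm x y n Fin.zero + binomialTerm x y n (Fin.fromℕ n)
          ≡⟨ cong₂ _+_ first last′ ⟩
        y ^ n + x ^ n                     ≡⟨ +-comm _ _ ⟩
        x ^ n + y ^ n                     ∎
        where
        first : binomialTerm x y n Fin.zero ≡ y ^ n
        first = trans (+-identityʳ _) (trans (*-identityˡ _) (sym (^≡Exp y n)))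
        last′ : binomialTerm x y n (Fin.fromℕ n) ≡ x ^ n
        last′ rewrite Fin.toℕ-fromℕ n-1 | nCn≡1 n | ℕ.n∸n≡0 n =
          trans (+-identityʳ _) (trans (*-identityʳ _) (sym (^≡Exp x n)))

  φ : ℕ → Carrier → Carrier
  φ i x = x ^ (p ^ℕ i)

  φ-∘ : ∀ i j x → φ i (φ j x) ≡ φ (i +ℕ j) x
  φ-∘ i j x = trans (^-assocʳ x (p ^ℕ j) (p ^ℕ i))
    (cong (x ^_) (trans (ℕ.*-comm (p ^ℕ j) (p ^ℕ i)) (sym (ℕ.^-distribˡ-+-* p i j))))

  φ-0 : ∀ x → φ 0 x ≡ x
  φ-0 = ^-identityʳ

  φ-* : ∀ i x y → φ i (x * y) ≡ φ i x * φ i y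
  φ-* i x y = ^-distribʳ-* x y (p ^ℕ i)

  φ-1# : ∀ i → φ i 1# ≡ 1#
  φ-1# i = ^-zeroˡ (p ^ℕ i)

  φ-suc : ∀ i x → φ (suc i) x ≡ φ i x ^ p
  φ-suc i x = trans (sym (φ-∘ 1 i x)) (cong (φ i x ^_) (ℕ.*-identityʳ p))

  φ-+ : ∀ i → Additive (φ i)
  φ-+ zero x y = trans (φ-0 _) (sym (cong₂ _+_ (φ-0 x) (φ-0 y)))
  φ-+ (suc i) x y rewrite φ-suc i (x + y) | φ-suc i x | φ-suc i y =
    trans (cong (_^ p) (φ-+ i x y)) (^p-distrib-+ _ _)

  φ-0# : ∀ i → φ i 0# ≡ 0#
  φ-0# i = additive-0 (φ-+ i)

  φ-neg : ∀ i x → φ i (- x) ≡ - φ i x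
  φ-neg i = additive-neg (φ-+ i)

  φ-≡0 : ∀ i {x} → φ i x ≡ 0# → x ≡ 0#
  φ-≡0 i = ^≡0⇒≡0 _ (p ^ℕ i)

  φ-nonzero : ∀ i {x} → ¬ x ≡ 0# → ¬ φ i x ≡ 0#
  φ-nonzero i x≢0 = x≢0 ∘ φ-≡0 i

  φ-injective : ∀ i → Injective _≡_ _≡_ (φ i)
  φ-injective i = additive-injective (φ-+ i) (λ _ → φ-≡0 i)

  φ-surjective : ∀ i y → ∃[ x ] φ i x ≡ y
  φ-surjective i = injective⇒surjective (φ i) (φ-injective i)

  φ-+m : ∀ i x → φ (i +ℕ m) x ≡ φ i x
  φ-+m i x = trans (sym (φ-∘ i m x)) (cong (φ i) (x^size≡x x))

  φ-*m : ∀ c x → φ (c *ℕ m) x ≡ x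
  φ-*m zero x = φ-0 x
  φ-*m (suc c) x = trans (cong (λ i → φ i x) (ℕ.+-comm m (c *ℕ m))) (trans (φ-+m (c *ℕ m) x) (φ-*m c x))

  -- Applying φ k an odd number 2 t + 1 of times flips the sign of y, yet is the identity.
  φ≡-⇒≡0 : ∀ k t → m ∣ t *ℕ (k +ℕ k) +ℕ k → ∀ y → φ k y ≡ - y → y ≡ 0#
  φ≡-⇒≡0 k t m∣ y φy≡-y = x+x≡0⇒x≡0 (begin
    y + y                               ≡⟨ cong (y +_) (φ-multiple m∣) ⟨
    y + φ (t *ℕ (k +ℕ k) +ℕ k) y        ≡⟨ cong (y +_) φ-odd ⟩
    y - y                               ≡⟨ -‿inverseʳ y ⟩
    0#                                  ∎)
    where
    open ≡-Reasoning
    φ-multiple : ∀ {j} → m ∣ j → φ j y ≡ y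
    φ-multiple (divides-refl c) = φ-*m c y
    φ-2k : φ (k +ℕ k) y ≡ y
    φ-2k = trans (sym (φ-∘ k k y)) (trans (cong (φ k) φy≡-y) (trans (φ-neg k y)
      (trans (cong -_ φy≡-y) (-‿involutive y))))
    φ-even : ∀ t → φ (t *ℕ (k +ℕ k)) y ≡ y
    φ-even zero = φ-0 y
    φ-even (suc t) = trans (sym (φ-∘ (k +ℕ k) (t *ℕ (k +ℕ k)) y)) (trans (cong (φ (k +ℕ k)) (φ-even t)) φ-2k)
    φ-odd : φ (t *ℕ (k +ℕ k) +ℕ k) y ≡ - y
    φ-odd = trans (cong (λ j → φ j y) (ℕ.+-comm (t *ℕ (k +ℕ k)) k))
      (trans (sym (φ-∘ k (t *ℕ (k +ℕ k)) y)) (trans (cong (φ k) (φ-even t)) φy≡-y))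

  φ-% : ∀ i x → φ i x ≡ φ (i % m) x
  φ-% i x = begin
    φ i x                              ≡⟨ cong (λ i → φ i x) (m≡m%n+[m/n]*n i m) ⟩
    φ (i % m +ℕ i / m *ℕ m) x          ≡⟨ φ-∘ (i % m) (i / m *ℕ m) x ⟨
    φ (i % m) (φ (i / m *ℕ m) x)       ≡⟨ cong (φ (i % m)) (φ-*m (i / m) x) ⟩
    φ (i % m) x                        ∎
    where open ≡-Reasoning

  -- Otherwise a may be reduced to a nonzero remainder below m, and x^(p^a) - x would have p^m
  -- roots, more than its degree.
  φ≡id⇒m∣ : ∀ a → (∀ x → φ a x ≡ x) → m ∣ a
  φ≡id⇒m∣ a fixed with a % m in eq
  ... | zero = m%n≡0⇒n∣m a m eq
  ... | suc b = ⊥-elim (fixed-points-bound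
      (ℕ.≤-trans (ℕ.nonTrivial⇒n>1 p) (ℕ.m≤m*n p (p ^ℕ b) {{ℕ.m^n≢0 p b}}))
      (ℕ.^-monoʳ-< p (ℕ.nonTrivial⇒n>1 p) (subst (_< m) eq (m%n<n a m)))
      elem elem-injective
      (λ i → trans (cong (λ b → φ b (elem i)) (sym eq)) (trans (sym (φ-% a (elem i))) (fixed (elem i)))))

  moved : ∀ a → m ∤ a → ∃[ x ] ¬ φ a x ≡ x
  moved a m∤a with search (λ x → ¬? (φ a x ≟ x))
  ... | yes found = found
  ... | no ¬found = ⊥-elim (m∤a (φ≡id⇒m∣ a (λ x → decidable-stable (φ a x ≟ x) (λ ne → ¬found (x , ne)))))

  -- The difference b - a is coprime to p, so Bézout writes 1 as a combination of two numbers that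
  -- both become 0 in the field.
  ·1-injective : ∀ {a b} → a < b → b < p → ¬ a · 1# ≡ b · 1#
  ·1-injective {a} {b} a<b b<p e = impossible (coprime-Bézout (prime⇒coprime p-prime d<p))
    where
    open ≡-Reasoning
    d = b ∸ a
    instance _ = ℕ.>-nonZero (ℕ.m<n⇒0<n∸m a<b)
    d<p : d < p
    d<p = ℕ.≤-<-trans (ℕ.m∸n≤m b a) b<p
    d·1≡0 : d · 1# ≡ 0#
    d·1≡0 = begin
      d · 1#                     ≡⟨ solve 2 (λ x y → x := y :+ x :- y) refl (d · 1#) (a · 1#) ⟩
      a · 1# + d · 1# - a · 1#   ≡⟨ cong (_- a · 1#) (×-homo-+ 1# a d) ⟨
      (a +ℕ d) · 1# - a · 1#     ≡⟨ cong (λ n → n · 1# - a · 1#) (ℕ.m+[n∸m]≡n (ℕ.<⇒≤ a<b)) ⟩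
      b · 1# - a · 1#            ≡⟨ x≡y⇒x-y≡0 (sym e) ⟩
      0#                         ∎
    1≢0 : ∀ {s t x y} → s · 1# ≡ 0# → t · 1# ≡ 0# → ¬ 1 +ℕ x *ℕ s ≡ y *ℕ t
    1≢0 {s} {t} {x} {y} es et eq = 0≢1 (sym (begin
      1#                            ≡⟨ +-identityʳ 1# ⟨
      1# + 0#                       ≡⟨ cong (1# +_) (trans (×1-homo-* x s) (trans (cong (x · 1# *_) es) (zeroʳ _))) ⟨
      (1 +ℕ x *ℕ s) · 1#            ≡⟨ cong (_· 1#) eq ⟩
      (y *ℕ t) · 1#                 ≡⟨ trans (×1-homo-* y t) (trans (cong (y · 1# *_) et) (zeroʳ _)) ⟩
      0#                            ∎))
    impossible : ¬ Bézout.Identity 1 p d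
    impossible (Bézout.+- x y eq) = 1≢0 {d} {p} {y} {x} d·1≡0 p·1≡0 eq
    impossible (Bézout.-+ x y eq) = 1≢0 {p} {d} {x} {y} p·1≡0 d·1≡0 eq

  ·1-fixed : ∀ n → (n · 1#) ^ p ≡ n · 1#
  ·1-fixed zero = trans (sym (cong (0# ^_) (ℕ.*-identityʳ p))) (φ-0# 1)
  ·1-fixed (suc n) = trans (^p-distrib-+ 1# (n · 1#)) (cong₂ _+_ (^-zeroˡ p) (·1-fixed n))

  -- The prime field already contains p roots of x ^ p - x.
  fixed⇒·1 : ∀ c → c ^ p ≡ c → ∃[ n ] c ≡ n · 1#
  fixed⇒·1 c c-fixed with Fin.any? (λ (i : Fin p) → c ≟ toℕ i · 1#)
  ... | yes (i , e) = toℕ i , e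
  ... | no ¬e = ⊥-elim (fixed-points-bound {p} (ℕ.nonTrivial⇒n>1 p) ℕ.≤-refl root root-injective root-fixed)
    where
    root : Fin (suc p) → Carrier
    root Fin.zero = c
    root (Fin.suc i) = toℕ i · 1#
    root-injective : Injective _≡_ _≡_ root
    root-injective {Fin.zero} {Fin.zero} _ = refl
    root-injective {Fin.zero} {Fin.suc j} e = ⊥-elim (¬e (j , e))
    root-injective {Fin.suc i} {Fin.zero} e = ⊥-elim (¬e (i , sym e))
    root-injective {Fin.suc i} {Fin.suc j} e with ℕ.<-cmp (toℕ i) (toℕ j)
    ... | tri< i<j _ _ = ⊥-elim (·1-injective i<j (Fin.toℕ<n j) e)
    ... | tri≈ _ i≡j _ = cong Fin.suc (Fin.toℕ-injective i≡j)
    ... | tri> _ _ j<i = ⊥-elim (·1-injective j<i (Fin.toℕ<n i) (sym e))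
    root-fixed : ∀ i → root i ^ p ≡ root i
    root-fixed Fin.zero = c-fixed
    root-fixed (Fin.suc i) = ·1-fixed (toℕ i)

  -- Linearized polynomials

  ∑ : ℕ → (ℕ → Carrier) → Carrier
  ∑ zero s = 0#
  ∑ (suc n) s = ∑ n s + s n

  ∑-cong : ∀ n {s t : ℕ → Carrier} → (∀ i → s i ≡ t i) → ∑ n s ≡ ∑ n t
  ∑-cong zero e = refl
  ∑-cong (suc n) e = cong₂ _+_ (∑-cong n e) (e n)

  ∑-zero : ∀ n {s : ℕ → Carrier} → (∀ i → i < n → s i ≡ 0#) → ∑ n s ≡ 0#
  ∑-zero zero e = refl
  ∑-zero (suc n) e =
    trans (cong₂ _+_ (∑-zero n (λ i i<n → e i (ℕ.m<n⇒m<1+n i<n))) (e n ℕ.≤-refl)) (+-identityˡ 0#)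

  ∑-distrib-+ : ∀ n (s t : ℕ → Carrier) → ∑ n (λ i → s i + t i) ≡ ∑ n s + ∑ n t
  ∑-distrib-+ zero s t = sym (+-identityˡ 0#)
  ∑-distrib-+ (suc n) s t = trans (cong (_+ (s n + t n)) (∑-distrib-+ n s t))
    (solve 4 (λ a b c d → a :+ b :+ (c :+ d) := a :+ c :+ (b :+ d)) refl (∑ n s) (∑ n t) (s n) (t n))

  ∑-additive : ∀ {f} → Additive f → ∀ n s → f (∑ n s) ≡ ∑ n (f ∘ s)
  ∑-additive f-add zero s = additive-0 f-add
  ∑-additive {f} f-add (suc n) s = trans (f-add _ _) (cong (_+ f (s n)) (∑-additive f-add n s))

  ∑-distribˡ-* : ∀ c n s → c * ∑ n s ≡ ∑ n (λ i → c * s i)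
  ∑-distribˡ-* c n s = ∑-additive (distribˡ c) n s

  ∑-single : ∀ n s t → t < n → (∀ i → i < n → ¬ i ≡ t → s i ≡ 0#) → ∑ n s ≡ s t
  ∑-single (suc n) s t t<n others with n ℕ.≟ t
  ... | yes refl = trans (cong (_+ s n)
    (∑-zero n (λ i i<n → others i (ℕ.m<n⇒m<1+n i<n) (ℕ.<⇒≢ i<n)))) (+-identityˡ (s n))
  ... | no n≢t = trans (cong₂ _+_
    (∑-single n s t (ℕ.≤∧≢⇒< (ℕ.s≤s⁻¹ t<n) (n≢t ∘ sym)) (λ i i<n → others i (ℕ.m<n⇒m<1+n i<n)))
    (others n ℕ.≤-refl n≢t)) (+-identityʳ (s t))

  ∑-suc : ∀ n s → s 0 + ∑ n (s ∘ suc) ≡ ∑ (suc n) s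
  ∑-suc zero s = +-comm _ _
  ∑-suc (suc n) s = trans (sym (+-assoc _ _ _)) (cong (_+ s (suc n)) (∑-suc n s))

  -- Coefficient sequences live on ℕ but are meant modulo m. Only their first m values enter `lin`;
  -- periodicity lets indices be shifted without treating wrap-around.
  Periodic : (ℕ → Carrier) → Set
  Periodic a = ∀ i → a (i +ℕ m) ≡ a i

  ∑-shift : ∀ {s} → Periodic s → ∀ j → ∑ m (λ i → s (i +ℕ j)) ≡ ∑ m s
  ∑-shift {s} s-per zero = ∑-cong m (λ i → cong s (ℕ.+-identityʳ i))
  ∑-shift {s} s-per (suc j) = begin
    ∑ m (λ i → s (i +ℕ suc j))
      ≡⟨ ∑-cong m (λ i → cong s (ℕ.+-suc i j)) ⟩
    ∑ m (t ∘ suc)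
      ≡⟨ solve 2 (λ a b → b := a :+ b :- a) refl (t 0) (∑ m (t ∘ suc)) ⟩
    t 0 + ∑ m (t ∘ suc) - t 0
      ≡⟨ cong (_- t 0) (∑-suc m t) ⟩
    ∑ m t + t m - t 0
      ≡⟨ cong (λ z → ∑ m t + z - t 0) (trans (cong s (ℕ.+-comm m j)) (s-per j)) ⟩
    ∑ m t + t 0 - t 0
      ≡⟨ solve 2 (λ a b → a :+ b :- b := a) refl (∑ m t) (t 0) ⟩
    ∑ m t
      ≡⟨ ∑-shift s-per j ⟩
    ∑ m s ∎
    where
    open ≡-Reasoning
    t = λ i → s (i +ℕ j)

  -- Dedekind's argument: subtracting χ n y times the relation at x from the relation
  -- at y * x removes the last character.
  independent : ∀ n (χ : ℕ → Carrier → Carrier) →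
    (∀ i x y → χ i (x * y) ≡ χ i x * χ i y) → (∀ i → χ i 1# ≡ 1#) →
    (∀ i j → i < j → j < n → ∃[ x ] ¬ χ i x ≡ χ j x) →
    (a : ℕ → Carrier) → (∀ x → ∑ n (λ i → a i * χ i x) ≡ 0#) → ∀ i → i < n → a i ≡ 0#
  independent (suc n) χ χ-* χ-1 distinct a vanish i i<n = case (ℕ.m<1+n⇒m<n∨m≡n i<n)
    where
    open ≡-Reasoning
    shorter : ∀ y x → ∑ n (λ i → a i * (χ i y - χ n y) * χ i x) ≡ 0#
    shorter y x = begin
      ∑ n (λ i → a i * (χ i y - χ n y) * χ i x)
        ≡⟨ solve 1 (λ s → s := s :+ con (ℤ.+ 0)) refl _ ⟩
      ∑ n (λ i → a i * (χ i y - χ n y) * χ i x) + 0#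
        ≡⟨ cong (∑ n (λ i → a i * (χ i y - χ n y) * χ i x) +_)
             (solve 3 (λ a y x → con (ℤ.+ 0) := a :* (y :- y) :* x) refl (a n) (χ n y) (χ n x)) ⟩
      ∑ (suc n) (λ i → a i * (χ i y - χ n y) * χ i x)
        ≡⟨ ∑-cong (suc n) (λ i → trans
             (solve 4 (λ a y z x → a :* (y :- z) :* x := a :* (y :* x) :+ :- z :* (a :* x)) refl
               (a i) (χ i y) (χ n y) (χ i x))
             (cong (λ w → a i * w + - χ n y * (a i * χ i x)) (sym (χ-* i y x)))) ⟩
      ∑ (suc n) (λ i → a i * χ i (y * x) + - χ n y * (a i * χ i x))
        ≡⟨ ∑-distrib-+ (suc n) _ _ ⟩
      ∑ (suc n) (λ i → a i * χ i (y * x)) + ∑ (suc n) (λ i → - χ n y * (a i * χ i x))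
        ≡⟨ cong₂ _+_ (vanish (y * x)) (trans (sym (∑-distribˡ-* (- χ n y) (suc n) _))
             (trans (cong (- χ n y *_) (vanish x)) (zeroʳ _))) ⟩
      0# + 0#
        ≡⟨ +-identityˡ 0# ⟩
      0# ∎
    below : ∀ i → i < n → a i ≡ 0#
    -- `y` separates the i-th character from the last one, so the factor that multiplies `a i` in
    -- the shortened relation is nonzero.
    below i i<n with distinct i n i<n ℕ.≤-refl
    ... | y , χiy≢χny = integral (χiy≢χny ∘ x-y≡0⇒x≡y) (trans (*-comm _ _)
      (independent n χ χ-* χ-1 (λ i j i<j j<n → distinct i j i<j (ℕ.m<n⇒m<1+n j<n))
        (λ i → a i * (χ i y - χ n y)) (shorter y) i i<n))
    case : i < n ⊎ i ≡ n → a i ≡ 0#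
    case (inj₁ i<n) = below i i<n
    case (inj₂ refl) = begin
      a n                                        ≡⟨ *-identityʳ (a n) ⟨
      a n * 1#                                   ≡⟨ cong (a n *_) (χ-1 n) ⟨
      a n * χ n 1#                               ≡⟨ +-identityˡ _ ⟨
      0# + a n * χ n 1#
        ≡⟨ cong (_+ a n * χ n 1#) (∑-zero n (λ i i<n → trans (cong (_* χ i 1#) (below i i<n)) (zeroˡ _))) ⟨
      ∑ (suc n) (λ i → a i * χ i 1#)             ≡⟨ vanish 1# ⟩
      0#                                         ∎

  φ-distinct : ∀ i j → i < j → m ∤ j ∸ i → ∃[ x ] ¬ φ i x ≡ φ j x
  φ-distinct i j i<j m∤j-i with moved (j ∸ i) m∤j-i
  ... | x , moves = x , λ e → moves (φ-injective i (trans (φ-∘ i (j ∸ i) x)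
    (trans (cong (λ l → φ l x) (ℕ.m+[n∸m]≡n (ℕ.<⇒≤ i<j))) (sym e))))

  lin : (ℕ → Carrier) → Carrier → Carrier
  lin a x = ∑ m (λ i → a i * φ i x)

  lin-+ : ∀ a → Additive (lin a)
  lin-+ a x y = trans
    (∑-cong m (λ i → trans (cong (a i *_) (φ-+ i x y)) (distribˡ (a i) _ _))) (∑-distrib-+ m _ _)

  lin-coeff-+ : ∀ a b x → lin (λ i → a i + b i) x ≡ lin a x + lin b x
  lin-coeff-+ a b x = trans (∑-cong m (λ i → distribʳ (φ i x) (a i) (b i))) (∑-distrib-+ m _ _)

  lin-coeff-* : ∀ c a x → lin (λ i → c * a i) x ≡ c * lin a x
  lin-coeff-* c a x = trans (∑-cong m (λ i → *-assoc c (a i) (φ i x))) (sym (∑-distribˡ-* c m _))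

  periodic-*m : ∀ {a} → Periodic a → ∀ i c → a (i +ℕ c *ℕ m) ≡ a i
  periodic-*m {a} a-per i zero = cong a (ℕ.+-identityʳ i)
  periodic-*m {a} a-per i (suc c) = trans (cong a (trans (cong (i +ℕ_) (ℕ.+-comm m (c *ℕ m))) (sym (ℕ.+-assoc i _ m))))
    (trans (a-per (i +ℕ c *ℕ m)) (periodic-*m a-per i c))

  periodic-% : ∀ {a} → Periodic a → ∀ i → a i ≡ a (i % m)
  periodic-% {a} a-per i = trans (cong a (m≡m%n+[m/n]*n i m)) (periodic-*m a-per (i % m) (i / m))

  -- The maps φ 0, ..., φ (m-1) are pairwise distinct characters, since m divides no j - i with i <
  -- j < m.
  lin≡0⇒≡0 : ∀ {a} → Periodic a → (∀ x → lin a x ≡ 0#) → ∀ i → a i ≡ 0#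
  lin≡0⇒≡0 a-per vanish i = trans (periodic-% a-per i)
    (independent m φ φ-* φ-1# (λ i j i<j j<m → φ-distinct i j i<j (m∤ i<j j<m)) _ vanish
      (i % m) (m%n<n i m))
    where
    m∤ : ∀ {i j} → i < j → j < m → m ∤ j ∸ i
    m∤ {i} {j} i<j j<m m∣ = ℕ.<⇒≱ (ℕ.≤-<-trans (ℕ.m∸n≤m j i) j<m)
      (∣⇒≤ {{ℕ.>-nonZero (ℕ.m<n⇒0<n∸m i<j)}} m∣)

  lin-injective : ∀ {a b} → Periodic a → Periodic b → (∀ x → lin a x ≡ lin b x) → ∀ i → a i ≡ b i
  lin-injective {a} {b} a-per b-per e i = x-y≡0⇒x≡y (trans
    (cong (a i +_) (sym (-1*x≈-x (b i))))
    (lin≡0⇒≡0 {λ i → a i + - 1# * b i} (λ i → cong₂ (λ a b → a + - 1# * b) (a-per i) (b-per i))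
      (λ x → trans (lin-coeff-+ a (λ i → - 1# * b i) x) (trans
        (cong₂ _+_ (e x) (trans (lin-coeff-* (- 1#) b x) (-1*x≈-x _))) (-‿inverseʳ _))) i))

  -- Since indices live in ℕ, the predecessor of i by k steps modulo m is
  -- written i + back k.
  back : ℕ → ℕ
  back k = k *ℕ (m ∸ 1)

  back+ : ∀ i k → i +ℕ back k +ℕ k ≡ i +ℕ k *ℕ m
  back+ i k = begin
    i +ℕ k *ℕ (m ∸ 1) +ℕ k           ≡⟨ ℕ.+-assoc i _ k ⟩
    i +ℕ (k *ℕ (m ∸ 1) +ℕ k)         ≡⟨ cong (i +ℕ_) (ℕ.+-comm _ k) ⟩
    i +ℕ (k +ℕ k *ℕ (m ∸ 1))         ≡⟨ cong (i +ℕ_) (ℕ.*-suc k (m ∸ 1)) ⟨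
    i +ℕ k *ℕ suc (m ∸ 1)            ≡⟨ cong (λ n → i +ℕ k *ℕ n) (ℕ.m+[n∸m]≡n 0<m) ⟩
    i +ℕ k *ℕ m                      ∎
    where open ≡-Reasoning

  +-back : ∀ i k → i +ℕ k +ℕ back k ≡ i +ℕ k *ℕ m
  +-back i k = trans (trans (ℕ.+-assoc i k _) (trans (cong (i +ℕ_) (ℕ.+-comm k _)) (sym (ℕ.+-assoc i _ k))))
    (back+ i k)

  shift-periodic : ∀ {a} → Periodic a → ∀ j → Periodic (λ i → a (i +ℕ j))
  shift-periodic {a} a-per j i = trans
    (cong a (trans (ℕ.+-assoc i m j) (trans (cong (i +ℕ_) (ℕ.+-comm m j)) (sym (ℕ.+-assoc i j m)))))
    (a-per (i +ℕ j))

  -- Raising every exponent by k is a shift of coefficients. Composing with `φ k` on either side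
  -- reduces to this; on the left the coefficients are raised to the power p^k as well.
  lin-shift : ∀ {a} → Periodic a → ∀ k x →
              lin (λ i → a (i +ℕ back k)) x ≡ ∑ m (λ i → a i * φ (i +ℕ k) x)
  lin-shift {a} a-per k x = begin
    ∑ m (λ i → a (i +ℕ back k) * φ i x)
      ≡⟨ ∑-shift (λ i → cong₂ _*_ (shift-periodic a-per (back k) i) (φ-+m i x)) k ⟨
    ∑ m (λ i → a (i +ℕ k +ℕ back k) * φ (i +ℕ k) x)
      ≡⟨ ∑-cong m (λ i → cong (_* φ (i +ℕ k) x)
           (trans (cong a (+-back i k)) (periodic-*m a-per i k))) ⟩
    ∑ m (λ i → a i * φ (i +ℕ k) x) ∎
    where open ≡-Reasoning

  lin-φ∘ : ∀ {a} → Periodic a → ∀ k x → lin (λ i → φ k (a (i +ℕ back k))) x ≡ φ k (lin a x)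
  lin-φ∘ {a} a-per k x = begin
    lin (λ i → φ k (a (i +ℕ back k))) x
      ≡⟨ lin-shift (λ i → cong (φ k) (a-per i)) k x ⟩
    ∑ m (λ i → φ k (a i) * φ (i +ℕ k) x)
      ≡⟨ ∑-cong m (λ i → cong (φ k (a i) *_) (trans (cong (λ l → φ l x) (ℕ.+-comm i k)) (sym (φ-∘ k i x)))) ⟩
    ∑ m (λ i → φ k (a i) * φ k (φ i x))
      ≡⟨ ∑-cong m (λ i → φ-* k (a i) (φ i x)) ⟨
    ∑ m (λ i → φ k (a i * φ i x))
      ≡⟨ ∑-additive (φ-+ k) m (λ i → a i * φ i x) ⟨
    φ k (lin a x) ∎
    where open ≡-Reasoning

  lin-scale : ∀ a c x → lin (λ i → a i * φ i c) x ≡ lin a (c * x)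
  lin-scale a c x = ∑-cong m (λ i → trans (*-assoc _ _ _) (cong (a i *_) (sym (φ-* i c x))))

  lin-∘φ : ∀ {a} → Periodic a → ∀ k x → lin (λ i → a (i +ℕ back k)) x ≡ lin a (φ k x)
  lin-∘φ {a} a-per k x = trans (lin-shift a-per k x) (∑-cong m (λ i → cong (a i *_) (sym (φ-∘ i k x))))

  -- The coefficient sequence of `φ t` itself, so that this monomial can take part in a comparison
  -- of coefficients.
  δ : ℕ → ℕ → Carrier
  δ t i with i % m ℕ.≟ t % m
  ... | yes _ = 1#
  ... | no _ = 0#

  δ-yes : ∀ {t i} → i % m ≡ t % m → δ t i ≡ 1#
  δ-yes {t} {i} e with i % m ℕ.≟ t % m
  ... | yes _ = refl
  ... | no ne = ⊥-elim (ne e)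

  δ-no : ∀ {t i} → ¬ i % m ≡ t % m → δ t i ≡ 0#
  δ-no {t} {i} ne with i % m ℕ.≟ t % m
  ... | yes e = ⊥-elim (ne e)
  ... | no _ = refl

  δ-periodic : ∀ t → Periodic (δ t)
  δ-periodic t i with i % m ℕ.≟ t % m
  ... | yes e = δ-yes {t} (trans (DM.[m+n]%n≡m%n i m) e)
  ... | no ne = δ-no {t} (ne ∘ trans (sym (DM.[m+n]%n≡m%n i m)))

  lin-single : ∀ {a} t → t < m → (∀ i → i < m → ¬ i ≡ t → a i ≡ 0#) → ∀ x → lin a x ≡ a t * φ t x
  lin-single {a} t t<m others x = ∑-single m (λ i → a i * φ i x) t t<m
    (λ i i<m i≢t → trans (cong (_* φ i x) (others i i<m i≢t)) (zeroˡ _))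

  lin-δ : ∀ t x → lin (δ t) x ≡ φ t x
  lin-δ t x = trans (lin-single (t % m) (m%n<n t m)
      (λ i i<m i≢t → δ-no {t} (i≢t ∘ trans (sym (DM.m<n⇒m%n≡m i<m)))) x)
    (trans (cong (_* φ (t % m) x) (δ-yes {t} (DM.m%n%n≡m%n t m))) (trans (*-identityˡ _) (sym (φ-% t x))))

  -- Every additive map is a linearized polynomial.

  Representable : (Carrier → Carrier) → Set
  Representable f = ∃[ a ] (Periodic a × (∀ x → f x ≡ lin a x))

  representable-additive : ∀ {f} → Representable f → Additive f
  representable-additive (a , _ , f≡) x y =
    trans (f≡ (x + y)) (trans (lin-+ a x y) (sym (cong₂ _+_ (f≡ x) (f≡ y))))

  representable-zero : Representable (λ _ → 0#)
  representable-zero = (λ _ → 0#) , (λ _ → refl) , λ x → sym (∑-zero m (λ i _ → zeroˡ _))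

  representable-id : Representable (λ x → x)
  representable-id = δ 0 , δ-periodic 0 , λ x → sym (trans (lin-δ 0 x) (φ-0 x))

  representable-axpy : ∀ {f g} → Representable f → ∀ c → Representable g → Representable (λ x → f x + c * g x)
  representable-axpy (a , a-per , f≡) c (b , b-per , g≡) =
    (λ i → a i + c * b i) , (λ i → cong₂ (λ a b → a + c * b) (a-per i) (b-per i)) ,
    λ x → trans (cong₂ (λ f g → f + c * g) (f≡ x) (g≡ x))
      (sym (trans (lin-coeff-+ a _ x) (cong (lin a x +_) (lin-coeff-* c b x))))

  representable-^p : ∀ {f} → Representable f → Representable (λ x → f x ^ p)
  representable-^p {f} (a , a-per , f≡) =
    (λ i → φ 1 (a (i +ℕ back 1))) , (λ i → cong (φ 1) (shift-periodic a-per (back 1) i)) ,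
    λ x → trans (cong (_^ p) (f≡ x)) (trans (sym (cong (lin a x ^_) (ℕ.*-identityʳ p))) (sym (lin-φ∘ a-per 1 x)))

  -- Newton interpolation: the zero set of P is an additive subgroup on which L
  -- agrees with f.  Replacing P by P ^ p - P z ^ (p - 1) P adjoins z to it.
  module _ {f : Carrier → Carrier} (f-add : Additive f) where
    Interpolates : (P L : Carrier → Carrier) → Set
    Interpolates P L = Representable P × Representable L × (∀ x → P x ≡ 0# → L x ≡ f x)

    adjoin : ∀ {P L} z → Interpolates P L →
             ∃[ P′ ] ∃[ L′ ] (Interpolates P′ L′ × (∀ x → P x ≡ 0# → P′ x ≡ 0#) × P′ z ≡ 0#)
    adjoin {P} {L} z int@(P-rep , L-rep , agree) with P z ≟ 0#
    ... | yes Pz≡0 = P , L , int , (λ _ e → e) , Pz≡0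
    ... | no d≢0 = P′ , L′ ,
        (representable-axpy (representable-^p P-rep) (- (d ^ p * d ⁻¹)) P-rep ,
         representable-axpy L-rep ε P-rep , agree′) , keep , at-z
      where
      open ≡-Reasoning
      d = P z
      -- Chosen so that L + ε P takes the value f z at z; on the zeros of P nothing changes.
      ε = (f z - L z) * d ⁻¹
      P′ L′ : Carrier → Carrier
      P′ x = P x ^ p + - (d ^ p * d ⁻¹) * P x
      L′ x = L x + ε * P x
      P-add = representable-additive P-rep

      0^p : 0# ^ p ≡ 0#
      0^p = trans (sym (cong (0# ^_) (ℕ.*-identityʳ p))) (φ-0# 1)

      keep : ∀ x → P x ≡ 0# → P′ x ≡ 0#
      keep x e rewrite e = trans (cong₂ _+_ 0^p (zeroʳ _)) (+-identityˡ 0#)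

      at-z : P′ z ≡ 0#
      at-z = begin
        d ^ p + - (d ^ p * d ⁻¹) * d     ≡⟨ solve 3 (λ D i d → D :+ :- (D :* i) :* d := D :- D :* (i :* d)) refl (d ^ p) (d ⁻¹) d ⟩
        d ^ p - d ^ p * (d ⁻¹ * d)       ≡⟨ cong (λ e → d ^ p - d ^ p * e) (⁻¹-inverseˡ d≢0) ⟩
        d ^ p - d ^ p * 1#               ≡⟨ solve 1 (λ D → D :- D :* con (ℤ.+ 1) := con (ℤ.+ 0)) refl (d ^ p) ⟩
        0#                               ∎

      -- The zeros of P′ are the x for which P x / P z lies in the prime field. If this ratio is n,
      -- then x - n z is a zero of P, where agreement is already known.
      ratio-fixed : ∀ x → P′ x ≡ 0# → (P x * d ⁻¹) ^ p ≡ P x * d ⁻¹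
      ratio-fixed x e = begin
        (P x * d ⁻¹) ^ p                       ≡⟨ ^-distribʳ-* (P x) (d ⁻¹) p ⟩
        P x ^ p * d ⁻¹ ^ p                     ≡⟨ cong (_* d ⁻¹ ^ p) (x-y≡0⇒x≡y (trans (solve 4 (λ X D i P → X :- D :* i :* P := X :+ :- (D :* i) :* P) refl (P x ^ p) (d ^ p) (d ⁻¹) (P x)) e)) ⟩
        d ^ p * d ⁻¹ * P x * d ⁻¹ ^ p          ≡⟨ solve 4 (λ D i P I → D :* i :* P :* I := D :* I :* (P :* i)) refl (d ^ p) (d ⁻¹) (P x) (d ⁻¹ ^ p) ⟩
        d ^ p * d ⁻¹ ^ p * (P x * d ⁻¹)        ≡⟨ cong (_* (P x * d ⁻¹)) (trans (sym (^-distribʳ-* d (d ⁻¹) p)) (trans (cong (_^ p) (⁻¹-inverseʳ d≢0)) (^-zeroˡ p))) ⟩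
        1# * (P x * d ⁻¹)                      ≡⟨ *-identityˡ _ ⟩
        P x * d ⁻¹                             ∎

      D : Carrier → Carrier
      D x = L′ x - f x

      D-add : Additive D
      D-add x y = trans (cong₂ _-_ (representable-additive (representable-axpy L-rep ε P-rep) x y) (f-add x y))
        (solve 4 (λ a b c d → a :+ b :- (c :+ d) := a :- c :+ (b :- d)) refl (L′ x) (L′ y) (f x) (f y))

      D-z : D z ≡ 0#
      D-z = begin
        L z + (f z - L z) * d ⁻¹ * d - f z     ≡⟨ solve 4 (λ l f i d → l :+ (f :- l) :* i :* d :- f := l :+ (f :- l) :* (i :* d) :- f) refl (L z) (f z) (d ⁻¹) d ⟩
        L z + (f z - L z) * (d ⁻¹ * d) - f z   ≡⟨ cong (λ e → L z + (f z - L z) * e - f z) (⁻¹-inverseˡ d≢0) ⟩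
        L z + (f z - L z) * 1# - f z           ≡⟨ solve 2 (λ l f → l :+ (f :- l) :* con (ℤ.+ 1) :- f := con (ℤ.+ 0)) refl (L z) (f z) ⟩
        0#                                     ∎

      D-zero : ∀ y → P y ≡ 0# → D y ≡ 0#
      D-zero y e = x≡y⇒x-y≡0 (trans (cong (λ w → L y + ε * w) e)
        (trans (trans (cong (L y +_) (zeroʳ ε)) (+-identityʳ _)) (agree y e)))

      n·0 : ∀ n → n · 0# ≡ 0#
      n·0 n = additive-0 {n ·_} (λ x y → n·-+ n x y)
        where
        n·-+ : ∀ n x y → n · (x + y) ≡ n · x + n · y
        n·-+ zero x y = sym (+-identityˡ 0#)
        n·-+ (suc n) x y = trans (cong (x + y +_) (n·-+ n x y))
          (solve 4 (λ x y a b → x :+ y :+ (a :+ b) := x :+ a :+ (y :+ b)) refl x y (n · x) (n · y))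

      agree′ : ∀ x → P′ x ≡ 0# → L′ x ≡ f x
      agree′ x e = x-y≡0⇒x≡y (begin
        D x                          ≡⟨ x-0≡x (D x) ⟨
        D x - 0#                     ≡⟨ cong (λ w → D x - w) (trans (additive-· D-add n z) (trans (cong (n ·_) D-z) (n·0 n))) ⟨
        D x - D (n · z)              ≡⟨ additive-minus D-add x (n · z) ⟨
        D (x - n · z)                ≡⟨ D-zero (x - n · z) P-vanishes ⟩
        0#                           ∎)
        where
        n = proj₁ (fixed⇒·1 (P x * d ⁻¹) (ratio-fixed x e))
        x-0≡x : ∀ x → x - 0# ≡ x
        x-0≡x = solve 1 (λ a → a :- con (ℤ.+ 0) := a) refl
        P-vanishes : P (x - n · z) ≡ 0#
        P-vanishes = trans (additive-minus P-add x (n · z)) (x≡y⇒x-y≡0 (begin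
          P x                  ≡⟨ *-identityʳ _ ⟨
          P x * 1#             ≡⟨ cong (P x *_) (⁻¹-inverseˡ d≢0) ⟨
          P x * (d ⁻¹ * d)     ≡⟨ *-assoc _ _ _ ⟨
          P x * d ⁻¹ * d       ≡⟨ cong (_* d) (proj₂ (fixed⇒·1 (P x * d ⁻¹) (ratio-fixed x e))) ⟩
          n · 1# * d           ≡⟨ trans (×-assoc-* n 1# d) (cong (n ·_) (*-identityˡ d)) ⟩
          n · d                ≡⟨ additive-· P-add n z ⟨
          P (n · z)            ∎))

    interpolate : ∀ n (t : Fin n → Carrier) →
                  ∃[ P ] ∃[ L ] (Interpolates P L × (∀ i → P (t i) ≡ 0#))
    -- P = x vanishes only at 0, where every additive map is 0.
    interpolate zero t = (λ x → x) , (λ _ → 0#) ,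
      (representable-id , representable-zero , (λ { x refl → sym (additive-0 f-add) })) , λ ()
    interpolate (suc n) t with interpolate n (t ∘ Fin.suc)
    ... | P , L , int , zeros with adjoin (t Fin.zero) int
    ...   | P′ , L′ , int′ , keep , at-z = P′ , L′ , int′ , λ
      { Fin.zero → at-z ; (Fin.suc i) → keep _ (zeros i) }

    representable : Representable f
    representable with interpolate _ elem
    ... | P , L , (_ , (a , a-per , L≡) , agree) , zeros = a , a-per , λ x →
      trans (sym (agree x (subst (λ x → P x ≡ 0#) (elem-index x) (zeros (index x))))) (L≡ x)

  -- The multiplication `_⋆_` and its elementary properties.

  module Star (k : ℕ) (m∤2k : m ∤ k +ℕ k) (m∤4k : m ∤ (k +ℕ k) +ℕ (k +ℕ k))
              (no-sign : ∀ y → φ k y ≡ - y → y ≡ 0#) where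
    q : Carrier → Carrier
    q = φ k

    infixl 7 _⋆_
    _⋆_ : Carrier → Carrier → Carrier
    x ⋆ u = q x * u + x * q u

    m∤k : m ∤ k
    m∤k m∣k = m∤2k (∣m∣n⇒∣m+n m∣k m∣k)

    ⋆-comm : ∀ x u → x ⋆ u ≡ u ⋆ x
    ⋆-comm x u = solve 4 (λ x u X U → X :* u :+ x :* U := U :* x :+ u :* X) refl x u (q x) (q u)

    ⋆-distribˡ : ∀ x → Additive (x ⋆_)
    ⋆-distribˡ x u v = trans (cong (λ w → q x * (u + v) + x * w) (φ-+ k u v))
      (solve 6 (λ x X u U v V → X :* (u :+ v) :+ x :* (U :+ V) := X :* u :+ x :* U :+ (X :* v :+ x :* V)) refl
        x (q x) u (q u) v (q v))

    ⋆-distribʳ : ∀ u → Additive (_⋆ u)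
    ⋆-distribʳ u x y = trans (⋆-comm (x + y) u)
      (trans (⋆-distribˡ u x y) (cong₂ _+_ (⋆-comm u x) (⋆-comm u y)))

    ⋆-zeroˡ : ∀ u → 0# ⋆ u ≡ 0#
    ⋆-zeroˡ u = additive-0 (⋆-distribʳ u)

    ⋆-zeroʳ : ∀ x → x ⋆ 0# ≡ 0#
    ⋆-zeroʳ x = additive-0 (⋆-distribˡ x)

    -- Dividing x^q u + x u^q = 0 by u^(q+1) shows that x / u is mapped by q to its negative, which
    -- `no-sign` permits only for 0.
    ⋆-integral : ∀ {x u} → ¬ u ≡ 0# → x ⋆ u ≡ 0# → x ≡ 0#
    ⋆-integral {x} {u} u≢0 e = begin
      x                ≡⟨ *-identityʳ x ⟨
      x * 1#           ≡⟨ cong (x *_) (⁻¹-inverseˡ u≢0) ⟨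
      x * (u ⁻¹ * u)   ≡⟨ *-assoc _ _ _ ⟨
      x * u ⁻¹ * u     ≡⟨ cong (_* u) (no-sign (x * u ⁻¹) negated) ⟩
      0# * u           ≡⟨ zeroˡ u ⟩
      0#               ∎
      where
      open ≡-Reasoning
      negated : q (x * u ⁻¹) ≡ - (x * u ⁻¹)
      negated = begin
        q (x * u ⁻¹)
          ≡⟨ φ-* k x (u ⁻¹) ⟩
        q x * q (u ⁻¹)
          ≡⟨ trans (cong (q x * q (u ⁻¹) *_) (⁻¹-inverseʳ u≢0)) (*-identityʳ _) ⟨
        q x * q (u ⁻¹) * (u * u ⁻¹)
          ≡⟨ solve 6 (λ X I u i x U → X :* I :* (u :* i) := (X :* u :+ x :* U) :* (I :* i) :- x :* i :* (U :* I)) refl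
               (q x) (q (u ⁻¹)) u (u ⁻¹) x (q u) ⟩
        (x ⋆ u) * (q (u ⁻¹) * u ⁻¹) - x * u ⁻¹ * (q u * q (u ⁻¹))
          ≡⟨ cong₂ (λ s t → s * (q (u ⁻¹) * u ⁻¹) - x * u ⁻¹ * t) e
               (trans (sym (φ-* k u (u ⁻¹))) (trans (cong q (⁻¹-inverseʳ u≢0)) (φ-1# k))) ⟩
        0# * (q (u ⁻¹) * u ⁻¹) - x * u ⁻¹ * 1#
          ≡⟨ solve 2 (λ a b → con (ℤ.+ 0) :* a :- b :* con (ℤ.+ 1) := :- b) refl
               (q (u ⁻¹) * u ⁻¹) (x * u ⁻¹) ⟩
        - (x * u ⁻¹) ∎

    ⋆-surjective : ∀ z → ∃[ x ] x ⋆ 1# ≡ z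
    ⋆-surjective = injective⇒surjective (_⋆ 1#)
      (additive-injective (⋆-distribʳ 1#) (λ _ → ⋆-integral (0≢1 ∘ sym)))

    1⋆-injective : ∀ {u v} → 1# ⋆ u ≡ 1# ⋆ v → u ≡ v
    1⋆-injective = additive-injective (⋆-distribˡ 1#)
      (λ u e → ⋆-integral (0≢1 ∘ sym) (trans (⋆-comm u 1#) e))

    -- The characters w, q w and q (q w) are distinct because m divides neither k nor 2k. The
    -- catch-all clauses below only make the families total; three terms are summed.
    independent₃ : ∀ a b c → (∀ w → a * w + b * q w + c * q (q w) ≡ 0#) →
                   a ≡ 0# × b ≡ 0# × c ≡ 0#
    independent₃ a b c vanish = coeff 0 (s≤s z≤n) , coeff 1 (s≤s (s≤s z≤n)) , coeff 2 ℕ.≤-refl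
      where
      χ : ℕ → Carrier → Carrier
      χ 0 w = w
      χ 1 w = q w
      χ (suc (suc _)) w = q (q w)
      coefficient : ℕ → Carrier
      coefficient 0 = a
      coefficient 1 = b
      coefficient (suc (suc _)) = c
      χ-* : ∀ i x y → χ i (x * y) ≡ χ i x * χ i y
      χ-* 0 x y = refl
      χ-* 1 x y = φ-* k x y
      χ-* (suc (suc _)) x y = trans (cong q (φ-* k x y)) (φ-* k (q x) (q y))
      χ-1 : ∀ i → χ i 1# ≡ 1#
      χ-1 0 = refl
      χ-1 1 = φ-1# k
      χ-1 (suc (suc _)) = trans (cong q (φ-1# k)) (φ-1# k)
      distinct : ∀ i j → i < j → j < 3 → ∃[ x ] ¬ χ i x ≡ χ j x
      distinct 0 1 _ _ with moved k m∤k
      ... | x , ne = x , ne ∘ sym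
      distinct 0 2 _ _ with moved (k +ℕ k) m∤2k
      ... | x , ne = x , λ e → ne (trans (sym (φ-∘ k k x)) (sym e))
      distinct 1 2 _ _ with moved k m∤k
      ... | x , ne = x , ne ∘ sym ∘ φ-injective k
      distinct (suc (suc _)) 2 (s≤s (s≤s ())) _
      distinct 1 1 (s≤s ()) _
      distinct _ (suc (suc (suc _))) _ (s≤s (s≤s (s≤s ())))
      coeff : ∀ i → i < 3 → coefficient i ≡ 0#
      coeff = independent 3 χ χ-* χ-1 distinct coefficient
        (λ w → trans (cong (λ s → s + b * q w + c * q (q w)) (+-identityˡ (a * w))) (vanish w))

    independent₂ : ∀ a b → (∀ w → a * w + b * q w ≡ 0#) → a ≡ 0# × b ≡ 0#
    independent₂ a b vanish = let a≡0 , b≡0 , _ = independent₃ a b 0# vanish₃ in a≡0 , b≡0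
      where
      vanish₃ : ∀ w → a * w + b * q w + 0# * q (q w) ≡ 0#
      vanish₃ w = trans (trans (cong (a * w + b * q w +_) (zeroˡ _)) (+-identityʳ _)) (vanish w)

    private
      -- In the relation at z the term K carries the factor z, in the relation at 1 the factor 1;
      -- subtracting z times the latter removes it. `Z`, `K`, `W` stand for the q-images of `z`,
      -- `H`, `w`, kept as free variables so that the solver sees a polynomial identity.
      eliminate : ∀ {α β z Z H K A C A₁ C₁ W w} →
        α * (Z * H) + β * (z * K) ≡ A * W + C * w → α * H + β * K ≡ A₁ * W + C₁ * w →
        α * (Z - z) * H ≡ (A - z * A₁) * W + (C - z * C₁) * w
      eliminate {α} {β} {z} {Z} {H} {K} {A} {C} {A₁} {C₁} {W} {w} e e₁ = begin
        α * (Z - z) * H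
          ≡⟨ solve 6 (λ α β z Z H K → α :* (Z :- z) :* H := α :* (Z :* H) :+ β :* (z :* K) :- z :* (α :* H :+ β :* K)) refl
               α β z Z H K ⟩
        α * (Z * H) + β * (z * K) - z * (α * H + β * K)
          ≡⟨ cong₂ (λ s t → s - z * t) e e₁ ⟩
        A * W + C * w - z * (A₁ * W + C₁ * w)
          ≡⟨ solve 7 (λ A C z A₁ C₁ W w → A :* W :+ C :* w :- z :* (A₁ :* W :+ C₁ :* w) := (A :- z :* A₁) :* W :+ (C :- z :* C₁) :* w) refl
               A C z A₁ C₁ W w ⟩
        (A - z * A₁) * W + (C - z * C₁) * w ∎
        where open ≡-Reasoning

      divide : ∀ {Δ H s t W w} → ¬ Δ ≡ 0# → Δ * H ≡ s * W + t * w → H ≡ Δ ⁻¹ * t * w + Δ ⁻¹ * s * W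
      divide {Δ} {H} {s} {t} {W} {w} Δ≢0 e = *-cancelˡ Δ≢0 (begin
        Δ * H
          ≡⟨ e ⟩
        s * W + t * w
          ≡⟨ trans (cong (_* (s * W + t * w)) (⁻¹-inverseʳ Δ≢0)) (*-identityˡ _) ⟨
        Δ * Δ ⁻¹ * (s * W + t * w)
          ≡⟨ solve 6 (λ D I s t W w → D :* I :* (s :* W :+ t :* w) := D :* (I :* t :* w :+ I :* s :* W)) refl
               Δ (Δ ⁻¹) s t W w ⟩
        Δ * (Δ ⁻¹ * t * w + Δ ⁻¹ * s * W) ∎)
        where open ≡-Reasoning

      substitute : ∀ {α β H K A C a b a′ b′ w W V} →
        α * H + β * K ≡ A * W + C * w → H ≡ a * w + b * W → K ≡ a′ * W + b′ * V →
        (α * a - C) * w + (α * b + β * a′ - A) * W + β * b′ * V ≡ 0#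
      substitute {α} {β} {_} {_} {A} {C} {a} {b} {a′} {b′} {w} {W} {V} e refl refl = trans
        (solve 11 (λ α β a b a′ b′ C A w W V → (α :* a :- C) :* w :+ (α :* b :+ β :* a′ :- A) :* W :+ β :* b′ :* V
          := α :* (a :* w :+ b :* W) :+ β :* (a′ :* W :+ b′ :* V) :- (A :* W :+ C :* w)) refl
          α β a b a′ b′ C A w W V)
        (x≡y⇒x-y≡0 e)

    -- Two values of z allow q (H w) to be eliminated, which exhibits H as a w + b q w;
    -- substituting this back, b is the coefficient of q (q w).
    scalar : ∀ {α β} → ¬ α ≡ 0# → ¬ β ≡ 0# → (H A C : Carrier → Carrier) →
             (∀ z w → α * (q z * H w) + β * (z * q (H w)) ≡ A z * q w + C z * w) →
             ∃[ c ] (∀ w → H w ≡ c * w)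
    -- The pivot of the elimination is α (q z - z), so z has to be moved by q.
    scalar {α} {β} α≢0 β≢0 H A C rel with moved k m∤k
    ... | z , qz≢z = a , λ w → trans (H≡ w)
        (trans (cong (λ b → a * w + b * q w) b≡0) (trans (cong (a * w +_) (zeroˡ _)) (+-identityʳ _)))
      where
      open ≡-Reasoning
      Δ = α * (q z - z)
      Δ≢0 : ¬ Δ ≡ 0#
      Δ≢0 = *-nonzero α≢0 (qz≢z ∘ x-y≡0⇒x≡y)
      a = Δ ⁻¹ * (C z - z * C 1#)
      b = Δ ⁻¹ * (A z - z * A 1#)
      rel₁ : ∀ w → α * H w + β * q (H w) ≡ A 1# * q w + C 1# * w
      rel₁ w = begin
        α * H w + β * q (H w)
          ≡⟨ solve 4 (λ α β H K → α :* H :+ β :* K := α :* (con (ℤ.+ 1) :* H) :+ β :* (con (ℤ.+ 1) :* K)) refl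
               α β (H w) (q (H w)) ⟩
        α * (1# * H w) + β * (1# * q (H w))
          ≡⟨ cong (λ e → α * (e * H w) + β * (1# * q (H w))) (φ-1# k) ⟨
        α * (q 1# * H w) + β * (1# * q (H w))
          ≡⟨ rel 1# w ⟩
        A 1# * q w + C 1# * w ∎
      H≡ : ∀ w → H w ≡ a * w + b * q w
      H≡ w = divide Δ≢0 (eliminate (rel z w) (rel₁ w))
      combination : ∀ w → (α * a - C 1#) * w + (α * b + β * q a - A 1#) * q w + β * q b * q (q w) ≡ 0#
      combination w = substitute (rel₁ w) (H≡ w)
        (trans (cong q (H≡ w)) (trans (φ-+ k _ _) (cong₂ _+_ (φ-* k a w) (φ-* k b (q w)))))
      b≡0 : b ≡ 0#
      b≡0 = φ-≡0 k (integral β≢0 (proj₂ (proj₂ (independent₃ _ _ _ combination))))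

    -- Orthogonal pairs of maps lie on lines.

    1≢0 : ¬ 1# ≡ 0#
    1≢0 = 0≢1 ∘ sym

    -- The point (a x , b x) stays on the line through (κ , κ′), with a bijective parameter G.
    -- Allowing κ or κ′ to be 0 covers the case of a vanishing component together with that of
    -- proportional ones.
    record Aligned (a b : Carrier → Carrier) : Set where
      field
        G : Carrier → Carrier
        G-injective : Injective _≡_ _≡_ G
        κ κ′ : Carrier
        a≡ : ∀ x → a x ≡ κ * G x
        b≡ : ∀ x → b x ≡ κ′ * G x

      G-surjective : ∀ y → ∃[ x ] G x ≡ y
      G-surjective = injective⇒surjective G G-injective

    swap-aligned : ∀ {a b} → Aligned a b → Aligned b a
    swap-aligned record { G = G ; G-injective = inj ; κ = κ ; κ′ = κ′ ; a≡ = a≡ ; b≡ = b≡ } =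
      record { G = G ; G-injective = inj ; κ = κ′ ; κ′ = κ ; a≡ = b≡ ; b≡ = a≡ }

    aligned-second : ∀ {a b} → Injective _≡_ _≡_ b → (∀ x → a x ≡ 0#) → Aligned a b
    aligned-second b-inj a≡0 = record
      { G-injective = b-inj ; κ = 0# ; κ′ = 1#
      ; a≡ = λ x → trans (a≡0 x) (sym (zeroˡ _)) ; b≡ = λ x → sym (*-identityˡ _) }

    -- Kept apart from `Aligned`, since a pair taken from the image (w , t) has no additive
    -- parameter at hand.
    AlignedAdditive : (a b : Carrier → Carrier) → Set
    AlignedAdditive a b = ∃[ al ] Additive (Aligned.G {a} {b} al)

    private
      cancel-first : ∀ {B₁ B₂ s t} → B₁ * s + B₂ * t ≡ 0# → s ≡ 0# → ¬ B₂ ≡ 0# → t ≡ 0#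
      cancel-first {B₁} {B₂} {t = t} e refl B₂≢0 = integral B₂≢0
        (trans (sym (+-identityˡ _)) (trans (cong (_+ B₂ * t) (sym (zeroʳ B₁))) e))

    -- If neither a nor b has a kernel, then writing b x = z the relation has the shape
    -- required by scalar for d as a function of c.
    module Orthogonal (a b c d : Carrier → Carrier) (a-add : Additive a) (b-add : Additive b)
      (ab-ker : ∀ x → a x ≡ 0# → b x ≡ 0# → x ≡ 0#) (cd-inj : ∀ u v → c u ≡ c v → d u ≡ d v → u ≡ v)
      {B₁ B₂ : Carrier} (B₁≢0 : ¬ B₁ ≡ 0#) (B₂≢0 : ¬ B₂ ≡ 0#)
      (orth : ∀ x v → B₁ * (a x ⋆ c v) + B₂ * (b x ⋆ d v) ≡ 0#) where

      -- With a x = 0 orthogonality leaves b x ⋆ d v = 0 and b x ≠ 0, so d vanishes. Then c alone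
      -- separates points, hence takes the value 1, and orthogonality against that value kills a.
      module Degenerate (x : Carrier) (x≢0 : ¬ x ≡ 0#) (ax≡0 : a x ≡ 0#) where
        d≡0 : ∀ v → d v ≡ 0#
        d≡0 v = ⋆-integral (λ bx≡0 → x≢0 (ab-ker x ax≡0 bx≡0)) (trans (⋆-comm (d v) (b x))
          (cancel-first (orth x v) (trans (cong (_⋆ c v) ax≡0) (⋆-zeroˡ (c v))) B₂≢0))

        c-inj : Injective _≡_ _≡_ c
        c-inj e = cd-inj _ _ e (trans (d≡0 _) (sym (d≡0 _)))

        a≡0 : ∀ y → a y ≡ 0#
        a≡0 y = let v , cv≡1 = injective⇒surjective c c-inj 1# in
          ⋆-integral 1≢0 (trans (cong (a y ⋆_) (sym cv≡1))
            (cancel-first (trans (+-comm _ _) (orth y v)) (trans (cong (b y ⋆_) (d≡0 v)) (⋆-zeroʳ (b y))) B₁≢0))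

        b-inj : Injective _≡_ _≡_ b
        b-inj = additive-injective b-add (λ y → ab-ker y (a≡0 y))

        conclusion : AlignedAdditive a b × Aligned c d
        conclusion = (aligned-second b-inj a≡0 , b-add) , swap-aligned (aligned-second c-inj d≡0)

      module Regular (a-inj : Injective _≡_ _≡_ a) (b-inj : Injective _≡_ _≡_ b) where
        b-nonzero : ∀ {x} → ¬ x ≡ 0# → ¬ b x ≡ 0#
        b-nonzero x≢0 e = x≢0 (b-inj (trans e (sym (additive-0 b-add))))

        c-inj : Injective _≡_ _≡_ c
        c-inj {u} {v} e = cd-inj u v e (additive-injective (⋆-distribˡ (b 1#))
          (λ w bw≡0 → ⋆-integral (b-nonzero 1≢0) (trans (⋆-comm w (b 1#)) bw≡0))
          (*-cancelˡ B₂≢0 (+-cancelˡ (B₁ * (a 1# ⋆ c u)) _ _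
            (trans (orth 1# u) (trans (sym (orth 1# v)) (cong (λ w → B₁ * (a 1# ⋆ w) + B₂ * (b 1# ⋆ d v)) (sym e)))))))

        c⁻¹ b⁻¹ : Carrier → Carrier
        c⁻¹ w = proj₁ (injective⇒surjective c c-inj w)
        b⁻¹ w = proj₁ (injective⇒surjective b b-inj w)

        c-c⁻¹ : ∀ w → c (c⁻¹ w) ≡ w
        c-c⁻¹ w = proj₂ (injective⇒surjective c c-inj w)

        b-b⁻¹ : ∀ w → b (b⁻¹ w) ≡ w
        b-b⁻¹ w = proj₂ (injective⇒surjective b b-inj w)

        relation : ∀ z w → B₂ * (q z * d (c⁻¹ w)) + B₂ * (z * q (d (c⁻¹ w)))
                   ≡ - (B₁ * a (b⁻¹ z)) * q w + - (B₁ * q (a (b⁻¹ z))) * w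
        relation z w = rearrange (trans
          (cong₂ (λ s t → B₁ * (a (b⁻¹ z) ⋆ s) + B₂ * (t ⋆ d (c⁻¹ w))) (sym (c-c⁻¹ w)) (sym (b-b⁻¹ z)))
          (orth (b⁻¹ z) (c⁻¹ w)))
          where
          rearrange : ∀ {s S w W z Z t T} → B₁ * (S * w + s * W) + B₂ * (Z * t + z * T) ≡ 0# →
                      B₂ * (Z * t) + B₂ * (z * T) ≡ - (B₁ * s) * W + - (B₁ * S) * w
          rearrange {s} {S} {w} {W} {z} {Z} {t} {T} e = x-y≡0⇒x≡y (trans
            (solve 10 (λ B₁ B₂ s S w W z Z t T → B₂ :* (Z :* t) :+ B₂ :* (z :* T) :- (:- (B₁ :* s) :* W :+ :- (B₁ :* S) :* w)
               := B₁ :* (S :* w :+ s :* W) :+ B₂ :* (Z :* t :+ z :* T)) refl B₁ B₂ s S w W z Z t T) e)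

        d-scalar : ∃[ λ′ ] (∀ w → d (c⁻¹ w) ≡ λ′ * w)
        d-scalar = scalar B₂≢0 B₂≢0 (d ∘ c⁻¹) _ _ relation

        λ′ = proj₁ d-scalar

        d≡ : ∀ v → d v ≡ λ′ * c v
        d≡ v = trans (cong d (c-inj (sym (c-c⁻¹ (c v))))) (proj₂ d-scalar (c v))

        -- Once d = λ′ c, orthogonality is a relation between w and q w for arbitrary w = c v. Its
        -- coefficient at q w ties a x to b x.
        coefficient : ∀ x → B₁ * a x + B₂ * (b x * q λ′) ≡ 0#
        coefficient x = proj₂ (independent₂ (B₁ * q (a x) + B₂ * (q (b x) * λ′)) _ vanish)
          where
          expand : ∀ s S t T l L w W → (B₁ * S + B₂ * (T * l)) * w + (B₁ * s + B₂ * (t * L)) * W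
                   ≡ B₁ * (S * w + s * W) + B₂ * (T * (l * w) + t * (L * W))
          expand s S t T l L w W = solve 10 (λ B₁ B₂ s S t T l L w W → (B₁ :* S :+ B₂ :* (T :* l)) :* w :+ (B₁ :* s :+ B₂ :* (t :* L)) :* W
            := B₁ :* (S :* w :+ s :* W) :+ B₂ :* (T :* (l :* w) :+ t :* (L :* W))) refl B₁ B₂ s S t T l L w W
          vanish : ∀ w → (B₁ * q (a x) + B₂ * (q (b x) * λ′)) * w + (B₁ * a x + B₂ * (b x * q λ′)) * q w ≡ 0#
          vanish w = begin
            (B₁ * q (a x) + B₂ * (q (b x) * λ′)) * w + (B₁ * a x + B₂ * (b x * q λ′)) * q w
              ≡⟨ expand (a x) (q (a x)) (b x) (q (b x)) λ′ (q λ′) w (q w) ⟩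
            B₁ * (a x ⋆ w) + B₂ * (q (b x) * (λ′ * w) + b x * (q λ′ * q w))
              ≡⟨ cong (λ e → B₁ * (a x ⋆ w) + B₂ * (q (b x) * (λ′ * w) + b x * e)) (φ-* k λ′ w) ⟨
            B₁ * (a x ⋆ w) + B₂ * (b x ⋆ (λ′ * w))
              ≡⟨ cong₂ (λ s t → B₁ * (a x ⋆ s) + B₂ * (b x ⋆ t)) (sym (c-c⁻¹ w))
                   (trans (cong (λ′ *_) (sym (c-c⁻¹ w))) (sym (d≡ (c⁻¹ w)))) ⟩
            B₁ * (a x ⋆ c (c⁻¹ w)) + B₂ * (b x ⋆ d (c⁻¹ w))
              ≡⟨ orth x (c⁻¹ w) ⟩
            0# ∎
            where open ≡-Reasoning

        a≡ : ∀ x → a x ≡ - (B₁ ⁻¹ * B₂ * q λ′) * b x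
        a≡ x = *-cancelˡ B₁≢0 (trans
          (solve 3 (λ s B t → s := s :+ B :* t :- B :* t) refl (B₁ * a x) B₂ (b x * q λ′))
          (trans (cong (_- B₂ * (b x * q λ′)) (coefficient x)) (unit (⁻¹-inverseʳ B₁≢0))))
          where
          unit : ∀ {B₁ I B₂ t L} → B₁ * I ≡ 1# → 0# - B₂ * (t * L) ≡ B₁ * (- (I * B₂ * L) * t)
          unit {B₁} {I} {B₂} {t} {L} e = trans
            (solve 3 (λ B t L → con (ℤ.+ 0) :- B :* (t :* L) := :- (con (ℤ.+ 1) :* (B :* L :* t))) refl B₂ t L)
            (trans (cong (λ e → - (e * (B₂ * L * t))) (sym e))
              (solve 5 (λ B₁ I B t L → :- (B₁ :* I :* (B :* L :* t)) := B₁ :* (:- (I :* B :* L) :* t)) refl B₁ I B₂ t L))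

        conclusion : AlignedAdditive a b × Aligned c d
        conclusion =
          (record { G-injective = b-inj ; a≡ = a≡ ; b≡ = λ x → sym (*-identityˡ (b x)) } , b-add) ,
          record { G-injective = c-inj ; a≡ = λ x → sym (*-identityˡ (c x)) ; b≡ = d≡ }

    aligned : ∀ {a b c d} → Additive a → Additive b →
      (∀ x → a x ≡ 0# → b x ≡ 0# → x ≡ 0#) → (∀ u v → c u ≡ c v → d u ≡ d v → u ≡ v) →
      ∀ {B} → ¬ B ≡ 0# → (∀ x v → (a x ⋆ c v) + B * (b x ⋆ d v) ≡ 0#) →
      AlignedAdditive a b × Aligned c d
    aligned {a} {b} {c} {d} a-add b-add ab-ker cd-inj {B} B≢0 orth =
      cases (search (λ x → ¬? (x ≟ 0#) ×-dec (a x ≟ 0#))) (search (λ x → ¬? (x ≟ 0#) ×-dec (b x ≟ 0#)))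
      where
      orth₁ : ∀ x v → 1# * (a x ⋆ c v) + B * (b x ⋆ d v) ≡ 0#
      orth₁ x v = trans (cong (_+ B * (b x ⋆ d v)) (*-identityˡ _)) (orth x v)

      module O = Orthogonal a b c d a-add b-add ab-ker cd-inj 1≢0 B≢0 orth₁
      -- The two weights B₁, B₂ exist for this: they make the setting symmetric, so a kernel of `b`
      -- is handled by the swapped instance.
      module O′ = Orthogonal b a d c b-add a-add (λ x e e′ → ab-ker x e′ e) (λ u v e e′ → cd-inj u v e′ e)
        B≢0 1≢0 (λ x v → trans (+-comm _ _) (orth₁ x v))

      ker⇒inj : ∀ {f} → Additive f → ¬ (∃[ x ] (¬ x ≡ 0# × f x ≡ 0#)) → Injective _≡_ _≡_ f
      ker⇒inj f-add none = additive-injective f-add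
        (λ x e → decidable-stable (x ≟ 0#) (λ x≢0 → none (x , x≢0 , e)))

      swap-both : AlignedAdditive b a × Aligned d c → AlignedAdditive a b × Aligned c d
      swap-both ((al , G-add) , al′) = (swap-aligned al , G-add) , swap-aligned al′

      cases : Dec (∃[ x ] (¬ x ≡ 0# × a x ≡ 0#)) → Dec (∃[ x ] (¬ x ≡ 0# × b x ≡ 0#)) →
              AlignedAdditive a b × Aligned c d
      cases (yes (x , x≢0 , ax≡0)) _ = O.Degenerate.conclusion x x≢0 ax≡0
      cases (no _) (yes (x , x≢0 , bx≡0)) = swap-both (O′.Degenerate.conclusion x x≢0 bx≡0)
      cases (no a-ker) (no b-ker) = O.Regular.conclusion (ker⇒inj a-add a-ker) (ker⇒inj b-add b-ker)

    -- Coefficients of isotopisms of ⋆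

    infix 4 _≋_
    _≋_ : ℕ → ℕ → Set
    i ≋ j = i % m ≡ j % m

    ≋-+ : ∀ {i j} c → i ≋ j → i +ℕ c ≋ j +ℕ c
    ≋-+ {i} {j} c e = trans (DM.%-distribˡ-+ i c m)
      (trans (cong (λ n → (n +ℕ c % m) % m) e) (sym (DM.%-distribˡ-+ j c m)))

    +-back≋ : ∀ i c → i +ℕ c +ℕ back c ≋ i
    +-back≋ i c = trans (cong (_% m) (+-back i c)) (DM.[m+kn]%n≡m%n i c m)

    back+≋ : ∀ i c → i +ℕ back c +ℕ c ≋ i
    back+≋ i c = trans (cong (_% m) (back+ i c)) (DM.[m+kn]%n≡m%n i c m)

    ≋-cancel : ∀ {i j} c → i +ℕ c ≋ j +ℕ c → i ≋ j
    ≋-cancel {i} {j} c e = trans (sym (+-back≋ i c)) (trans (≋-+ (back c) e) (+-back≋ j c))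

    i≋i+c⇒m∣c : ∀ i {c} → i ≋ i +ℕ c → m ∣ c
    i≋i+c⇒m∣c i {c} e = m%n≡0⇒n∣m c m (trans (sym (≋-cancel {0} {c} i (trans e (cong (_% m) (ℕ.+-comm i c))))) (DM.m<n⇒m%n≡m 0<m))

    -- f (x ⋆ u) = γ (g x ⋆ g u) is a relation between the coefficients aᵢ of f and
    -- bᵢ of g.  Comparing the terms in x ^ pⁱ and u ^ pˡ gives bᵢ₋ₖ^q bₗ + bᵢ bₗ₋ₖ^q = 0
    -- unless l is i - k or i + k, since f contributes to these two only.
    module Coefficients {f g : Carrier → Carrier} {a b : ℕ → Carrier}
      (a-per : Periodic a) (b-per : Periodic b)
      (f≡ : ∀ x → f x ≡ lin a x) (g≡ : ∀ x → g x ≡ lin b x)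
      {γ : Carrier} (γ≢0 : ¬ γ ≡ 0#) (f-add : Additive f) (rel : ∀ x u → f (x ⋆ u) ≡ γ * (g x ⋆ g u)) where

      infixl 9 _′
      _′ : ℕ → ℕ
      i ′ = i +ℕ back k

      b-≋ : ∀ {i j} → i ≋ j → b i ≡ b j
      b-≋ {i} {j} e = trans (periodic-% b-per i) (trans (cong b e) (sym (periodic-% b-per j)))

      -- For fixed u both sides of `rel` are linearized polynomials in x. The equality of their
      -- coefficients is in turn an identity of linearized polynomials in u, which `compare-u`
      -- expands.
      compare-x : ∀ u i → a (i ′) * φ (i ′) u + a i * φ i (q u)
                  ≡ γ * g u * q (b (i ′)) + γ * q (g u) * b i
      compare-x u = lin-injective
        (λ i → cong₂ _+_ (scaled-periodic u (back k) i) (cong₂ _*_ (a-per i) (φ-+m i (q u))))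
        (λ i → cong₂ (λ s t → γ * g u * q s + γ * q (g u) * t) (shift-periodic b-per (back k) i) (b-per i))
        (λ x → trans (left x) (trans (rel x u) (right x)))
        where
        open ≡-Reasoning
        scaled-periodic : ∀ u j → Periodic (λ i → a (i +ℕ j) * φ (i +ℕ j) u)
        scaled-periodic u = shift-periodic {λ i → a i * φ i u} (λ i → cong₂ _*_ (a-per i) (φ-+m i u))
        left : ∀ x → lin (λ i → a (i ′) * φ (i ′) u + a i * φ i (q u)) x ≡ f (x ⋆ u)
        left x = begin
          lin (λ i → a (i ′) * φ (i ′) u + a i * φ i (q u)) x
            ≡⟨ lin-coeff-+ _ _ x ⟩
          lin (λ i → a (i ′) * φ (i ′) u) x + lin (λ i → a i * φ i (q u)) x
            ≡⟨ cong₂ _+_ (trans (lin-∘φ {λ i → a i * φ i u} (λ i → cong₂ _*_ (a-per i) (φ-+m i u)) k x) (lin-scale a u (q x)))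
                 (lin-scale a (q u) x) ⟩
          lin a (u * q x) + lin a (q u * x)
            ≡⟨ cong₂ _+_ (trans (cong (lin a) (*-comm _ _)) (sym (f≡ _))) (trans (cong (lin a) (*-comm _ _)) (sym (f≡ _))) ⟩
          f (q x * u) + f (x * q u)
            ≡⟨ f-add _ _ ⟨
          f (x ⋆ u) ∎
        right : ∀ x → γ * (g x ⋆ g u) ≡ lin (λ i → γ * g u * q (b (i ′)) + γ * q (g u) * b i) x
        right x = begin
          γ * (q (g x) * g u + g x * q (g u))
            ≡⟨ solve 5 (λ γ x X u U → γ :* (X :* u :+ x :* U) := γ :* u :* X :+ γ :* U :* x) refl γ (g x) (q (g x)) (g u) (q (g u)) ⟩
          γ * g u * q (g x) + γ * q (g u) * g x
            ≡⟨ cong₂ (λ s t → γ * g u * s + γ * q (g u) * t) (trans (lin-φ∘ b-per k x) (cong q (sym (g≡ x)))) (sym (g≡ x)) ⟨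
          γ * g u * lin (λ i → q (b (i ′))) x + γ * q (g u) * lin b x
            ≡⟨ cong₂ _+_ (lin-coeff-* (γ * g u) (λ i → q (b (i ′))) x) (lin-coeff-* (γ * q (g u)) b x) ⟨
          lin (λ i → γ * g u * q (b (i ′))) x + lin (λ i → γ * q (g u) * b i) x
            ≡⟨ lin-coeff-+ _ _ x ⟨
          lin (λ i → γ * g u * q (b (i ′)) + γ * q (g u) * b i) x ∎

      compare-u : ∀ i l → a (i ′) * δ (i ′) l + a i * δ (i +ℕ k) l
                  ≡ γ * q (b (i ′)) * b l + γ * b i * q (b (l ′))
      compare-u i = lin-injective
        (λ l → cong₂ (λ s t → a (i ′) * s + a i * t) (δ-periodic (i ′) l) (δ-periodic (i +ℕ k) l))
        (λ l → cong₂ (λ s t → γ * q (b (i ′)) * s + γ * b i * q t) (b-per l) (shift-periodic b-per (back k) l))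
        (λ u → trans (left u) (trans (compare-x u i) (right u)))
        where
        open ≡-Reasoning
        left : ∀ u → lin (λ l → a (i ′) * δ (i ′) l + a i * δ (i +ℕ k) l) u ≡ a (i ′) * φ (i ′) u + a i * φ i (q u)
        left u = begin
          lin (λ l → a (i ′) * δ (i ′) l + a i * δ (i +ℕ k) l) u
            ≡⟨ lin-coeff-+ _ _ u ⟩
          lin (λ l → a (i ′) * δ (i ′) l) u + lin (λ l → a i * δ (i +ℕ k) l) u
            ≡⟨ cong₂ _+_ (lin-coeff-* (a (i ′)) (δ (i ′)) u) (lin-coeff-* (a i) (δ (i +ℕ k)) u) ⟩
          a (i ′) * lin (δ (i ′)) u + a i * lin (δ (i +ℕ k)) u
            ≡⟨ cong₂ (λ s t → a (i ′) * s + a i * t) (lin-δ (i ′) u) (trans (lin-δ (i +ℕ k) u) (sym (φ-∘ i k u))) ⟩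
          a (i ′) * φ (i ′) u + a i * φ i (q u) ∎
        right : ∀ u → γ * g u * q (b (i ′)) + γ * q (g u) * b i
                      ≡ lin (λ l → γ * q (b (i ′)) * b l + γ * b i * q (b (l ′))) u
        right u = begin
          γ * g u * q (b (i ′)) + γ * q (g u) * b i
            ≡⟨ solve 5 (λ γ u U s t → γ :* u :* s :+ γ :* U :* t := γ :* s :* u :+ γ :* t :* U) refl
                 γ (g u) (q (g u)) (q (b (i ′))) (b i) ⟩
          γ * q (b (i ′)) * g u + γ * b i * q (g u)
            ≡⟨ cong₂ (λ s t → γ * q (b (i ′)) * s + γ * b i * t) (sym (g≡ u)) (trans (lin-φ∘ b-per k u) (cong q (sym (g≡ u)))) ⟨
          γ * q (b (i ′)) * lin b u + γ * b i * lin (λ l → q (b (l ′))) u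
            ≡⟨ cong₂ _+_ (lin-coeff-* (γ * q (b (i ′))) b u) (lin-coeff-* (γ * b i) (λ l → q (b (l ′))) u) ⟨
          lin (λ l → γ * q (b (i ′)) * b l) u + lin (λ l → γ * b i * q (b (l ′))) u
            ≡⟨ lin-coeff-+ _ _ u ⟨
          lin (λ l → γ * q (b (i ′)) * b l + γ * b i * q (b (l ′))) u ∎

      off-diagonal : ∀ i l → ¬ l ≋ i ′ → ¬ l ≋ i +ℕ k → q (b (i ′)) * b l + b i * q (b (l ′)) ≡ 0#
      off-diagonal i l l≢i′ l≢i+k = integral γ≢0 (trans
        (solve 5 (λ γ s t u v → γ :* (s :* t :+ u :* v) := γ :* s :* t :+ γ :* u :* v) refl γ (q (b (i ′))) (b l) (b i) (q (b (l ′))))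
        (trans (sym (compare-u i l))
          (trans (cong₂ (λ s t → a (i ′) * s + a i * t) (δ-no {i ′} l≢i′) (δ-no {i +ℕ k} l≢i+k))
            (trans (cong₂ _+_ (zeroʳ _) (zeroʳ _)) (+-identityˡ 0#)))))

      -- For l = i the two terms coincide, and the characteristic is odd; l = i avoids both
      -- exceptional indices because m does not divide k.
      adjacent : ∀ i → ¬ b (i ′) ≡ 0# → b i ≡ 0#
      adjacent i b≢0 = integral (φ-nonzero k b≢0) (x+x≡0⇒x≡0 (trans
        (cong (q (b (i ′)) * b i +_) (*-comm _ _))
        (off-diagonal i i (λ e → m∤k (i≋i+c⇒m∣c (i ′) (trans (sym e) (sym (back+≋ i k)))))
          (λ e → m∤k (i≋i+c⇒m∣c i e)))))

      -- As b i = 0 by `adjacent`, the second term of the off-diagonal relation drops out.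
      two-left : ∀ i → ¬ b (i ′) ≡ 0# → ∀ l → ¬ l ≋ i ′ → ¬ l ≋ i +ℕ k → b l ≡ 0#
      two-left i b≢0 l l≢i′ l≢i+k = integral (φ-nonzero k b≢0) (trans
        (sym (trans (cong (q (b (i ′)) * b l +_) (trans (cong (_* q (b (l ′))) (adjacent i b≢0)) (zeroˡ _))) (+-identityʳ _)))
        (off-diagonal i l l≢i′ l≢i+k))

      -- If the remaining candidate l = i + k had b l ≠ 0, then starting from l only l and l + 2k
      -- could carry coefficients. The index i - k would have to be one of them; it is not l, and i
      -- - k = i + 3k modulo m contradicts `m∤4k`.
      one-left : ∀ i → ¬ b (i ′) ≡ 0# → ∀ l → ¬ l ≋ i ′ → b l ≡ 0#
      one-left i b≢0 l l≢i′ with l % m ℕ.≟ (i +ℕ k) % m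
      ... | no l≢i+k = two-left i b≢0 l l≢i′ l≢i+k
      ... | yes l≋i+k = decidable-stable (b l ≟ 0#) λ bl≢0 → b≢0
        (two-left (l +ℕ k) (bl≢0 ∘ trans (sym (b-≋ (+-back≋ l k)))) (i ′)
          (λ e → l≢i′ (sym (trans e (+-back≋ l k))))
          (λ e → m∤4k (i≋i+c⇒m∣c i (begin
            i % m                                     ≡⟨ back+≋ i k ⟨
            (i ′ +ℕ k) % m                            ≡⟨ ≋-+ k e ⟩
            (l +ℕ k +ℕ k +ℕ k) % m                    ≡⟨ ≋-+ k (≋-+ k (≋-+ k l≋i+k)) ⟩
            (i +ℕ k +ℕ k +ℕ k +ℕ k) % m               ≡⟨ cong (_% m) (reassociate i k) ⟩
            (i +ℕ ((k +ℕ k) +ℕ (k +ℕ k))) % m         ∎))))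
        where
        open ≡-Reasoning
        reassociate : ∀ i k → i +ℕ k +ℕ k +ℕ k +ℕ k ≡ i +ℕ ((k +ℕ k) +ℕ (k +ℕ k))
        reassociate = ℕS.solve 2 (λ i k → i ℕS.:+ k ℕS.:+ k ℕS.:+ k ℕS.:+ k ℕS.:= i ℕS.:+ ((k ℕS.:+ k) ℕS.:+ (k ℕS.:+ k))) refl

      monomial : ¬ g 1# ≡ 0# → ∃[ i ] ∃[ c ] (∀ x → g x ≡ c * φ i x)
      monomial g1≢0 with Fin.any? (λ (t : Fin m) → ¬? (b (toℕ t) ≟ 0#))
      ... | yes (t , bt≢0) = toℕ t , b (toℕ t) , λ x → trans (g≡ x) (lin-single (toℕ t) (Fin.toℕ<n t)
            (λ i i<m i≢t → one-left (toℕ t +ℕ k) (bt≢0 ∘ trans (sym (b-≋ (+-back≋ (toℕ t) k)))) i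
              (λ e → i≢t (trans (sym (DM.m<n⇒m%n≡m i<m)) (trans (trans e (+-back≋ (toℕ t) k)) (DM.m<n⇒m%n≡m (Fin.toℕ<n t)))))) x)
      ... | no none = ⊥-elim (g1≢0 (trans (g≡ 1#) (∑-zero m (λ i i<m →
            trans (cong (_* φ i 1#) (trans (cong b (sym (Fin.toℕ-fromℕ< i<m)))
              (decidable-stable (b (toℕ (Fin.fromℕ< i<m)) ≟ 0#) (λ ne → none (Fin.fromℕ< i<m , ne))))) (zeroˡ _)))))

    -- Once g = c φ i, the relation at u = 1 gives f on all x ⋆ 1, which is the whole field. The
    -- constant of f is γ c^(q+1).
    isotopism-monomial : ∀ {f g γ} → Additive f → Additive g → Injective _≡_ _≡_ g → ¬ γ ≡ 0# →
      (∀ x u → f (x ⋆ u) ≡ γ * (g x ⋆ g u)) →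
      ∃[ i ] ∃[ c ] ∃[ c′ ] ((∀ x → g x ≡ c * φ i x) × (∀ x → f x ≡ c′ * φ i x))
    isotopism-monomial {f} {g} {γ} f-add g-add g-inj γ≢0 rel = i , c , c′ , g≡ , f≡
      where
      open ≡-Reasoning
      f-rep = representable f-add
      g-rep = representable g-add
      g-mono = Coefficients.monomial (proj₁ (proj₂ f-rep)) (proj₁ (proj₂ g-rep)) (proj₂ (proj₂ f-rep)) (proj₂ (proj₂ g-rep))
        γ≢0 f-add rel (λ e → 1≢0 (g-inj (trans e (sym (additive-0 g-add)))))
      i = proj₁ g-mono
      c = proj₁ (proj₂ g-mono)
      g≡ = proj₂ (proj₂ g-mono)
      c′ = γ * (q c * c)
      φq : ∀ x → φ i (q x) ≡ q (φ i x)
      φq x = trans (φ-∘ i k x) (trans (cong (λ j → φ j x) (ℕ.+-comm i k)) (sym (φ-∘ k i x)))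
      f≡⋆ : ∀ x → f (x ⋆ 1#) ≡ c′ * φ i (x ⋆ 1#)
      f≡⋆ x = begin
        f (x ⋆ 1#)
          ≡⟨ rel x 1# ⟩
        γ * (q (g x) * g 1# + g x * q (g 1#))
          ≡⟨ cong₂ (λ s t → γ * (q s * t + s * q t)) (g≡ x) (g≡ 1#) ⟩
        γ * (q (c * φ i x) * (c * φ i 1#) + c * φ i x * q (c * φ i 1#))
          ≡⟨ cong₂ (λ s t → γ * (s * (c * φ i 1#) + c * φ i x * t)) (φ-* k c (φ i x)) (φ-* k c (φ i 1#)) ⟩
        γ * (q c * q (φ i x) * (c * φ i 1#) + c * φ i x * (q c * q (φ i 1#)))
          ≡⟨ solve 7 (λ γ c C x X u U → γ :* (C :* X :* (c :* u) :+ c :* x :* (C :* U)) := γ :* (C :* c) :* (X :* u :+ x :* U)) refl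
               γ c (q c) (φ i x) (q (φ i x)) (φ i 1#) (q (φ i 1#)) ⟩
        c′ * (q (φ i x) * φ i 1# + φ i x * q (φ i 1#))
          ≡⟨ cong₂ (λ s t → c′ * (s * φ i 1# + φ i x * t)) (φq x) (φq 1#) ⟨
        c′ * (φ i (q x) * φ i 1# + φ i x * φ i (q 1#))
          ≡⟨ cong (c′ *_) (trans (φ-+ i _ _) (cong₂ _+_ (φ-* i (q x) 1#) (φ-* i x (q 1#)))) ⟨
        c′ * φ i (x ⋆ 1#) ∎
      f≡ : ∀ z → f z ≡ c′ * φ i z
      f≡ z = let x , x⋆1≡z = ⋆-surjective z in
        subst (λ z → f z ≡ c′ * φ i z) x⋆1≡z (f≡⋆ x)

    -- The left-hand side is symmetric in x and u, which forces H to be a multiple of G.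
    autotopism-monomial : ∀ {f G H α β} → Additive f → Injective _≡_ _≡_ f →
      Additive G → Injective _≡_ _≡_ G → ¬ α ≡ 0# → ¬ β ≡ 0# →
      (∀ x u → f (x ⋆ u) ≡ α * (q (G x) * H u) + β * (G x * q (H u))) →
      ∃[ i ] ∃[ c ] ∃[ c′ ] ∃[ c″ ]
        ((∀ x → G x ≡ c * φ i x) × (∀ x → H x ≡ c′ * φ i x) × (∀ x → f x ≡ c″ * φ i x))
    autotopism-monomial {f} {G} {H} {α} {β} f-add f-inj G-add G-inj α≢0 β≢0 rel =
      i , c , s * c , c″ , G≡ , (λ x → trans (H≡ x) (trans (cong (s *_) (G≡ x)) (sym (*-assoc _ _ _)))) , f≡
      where
      open ≡-Reasoning
      G⁻¹ : Carrier → Carrier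
      G⁻¹ z = proj₁ (injective⇒surjective G G-inj z)
      G-G⁻¹ : ∀ z → G (G⁻¹ z) ≡ z
      G-G⁻¹ z = proj₂ (injective⇒surjective G G-inj z)

      B-at : ∀ z w → f (G⁻¹ z ⋆ G⁻¹ w) ≡ α * (q z * H (G⁻¹ w)) + β * (z * q (H (G⁻¹ w)))
      B-at z w = trans (rel (G⁻¹ z) (G⁻¹ w))
        (cong (λ z → α * (q z * H (G⁻¹ w)) + β * (z * q (H (G⁻¹ w)))) (G-G⁻¹ z))

      symmetric : ∀ z w → α * (q z * H (G⁻¹ w)) + β * (z * q (H (G⁻¹ w)))
                  ≡ α * H (G⁻¹ z) * q w + β * q (H (G⁻¹ z)) * w
      symmetric z w = begin
        α * (q z * H (G⁻¹ w)) + β * (z * q (H (G⁻¹ w)))   ≡⟨ B-at z w ⟨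
        f (G⁻¹ z ⋆ G⁻¹ w)                                 ≡⟨ cong f (⋆-comm (G⁻¹ z) (G⁻¹ w)) ⟩
        f (G⁻¹ w ⋆ G⁻¹ z)                                 ≡⟨ B-at w z ⟩
        α * (q w * H (G⁻¹ z)) + β * (w * q (H (G⁻¹ z)))
          ≡⟨ solve 6 (λ α β w W t T → α :* (W :* t) :+ β :* (w :* T) := α :* t :* W :+ β :* T :* w) refl
               α β w (q w) (H (G⁻¹ z)) (q (H (G⁻¹ z))) ⟩
        α * H (G⁻¹ z) * q w + β * q (H (G⁻¹ z)) * w       ∎

      H-scalar : ∃[ s ] (∀ w → H (G⁻¹ w) ≡ s * w)
      H-scalar = scalar α≢0 β≢0 (H ∘ G⁻¹) _ _ symmetric

      s = proj₁ H-scalar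

      H≡ : ∀ x → H x ≡ s * G x
      H≡ x = trans (cong H (G-inj (sym (G-G⁻¹ (G x))))) (proj₂ H-scalar (G x))

      -- With H = s G the symmetry relation at w = 1 compares coefficients of z and q z. The
      -- equality lets both terms of `rel` merge into a multiple of G x ⋆ G u.
      αs≡βqs : α * s ≡ β * q s
      αs≡βqs = x-y≡0⇒x≡y (proj₂ (independent₂ (β * q s - α * s) (α * s - β * q s) (λ z →
        at-1 (φ-1# k) (trans (proj₂ H-scalar 1#) (*-identityʳ s)) refl
          (proj₂ H-scalar z) (trans (cong q (proj₂ H-scalar z)) (φ-* k s z)) (symmetric z 1#))))
        where
        at-1 : ∀ {z Z t T u U e} → e ≡ 1# → t ≡ s → T ≡ q t → u ≡ s * z → U ≡ q s * Z →
               α * (Z * t) + β * (z * T) ≡ α * u * e + β * U * 1# →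
               (β * q s - α * s) * z + (α * s - β * q s) * Z ≡ 0#
        at-1 {z} {Z} refl refl refl refl refl eq = trans
          (solve 6 (λ α β s S z Z → (β :* S :- α :* s) :* z :+ (α :* s :- β :* S) :* Z
            := α :* (Z :* s) :+ β :* (z :* S) :- (α :* (s :* z) :* con (ℤ.+ 1) :+ β :* (S :* Z) :* con (ℤ.+ 1))) refl α β s (q s) z Z)
          (x≡y⇒x-y≡0 eq)

      rel′ : ∀ x u → f (x ⋆ u) ≡ α * s * (G x ⋆ G u)
      rel′ x u = begin
        f (x ⋆ u)
          ≡⟨ rel x u ⟩
        α * (q (G x) * H u) + β * (G x * q (H u))
          ≡⟨ cong₂ (λ t T → α * (q (G x) * t) + β * (G x * T)) (H≡ u) (trans (cong q (H≡ u)) (φ-* k s (G u))) ⟩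
        α * (q (G x) * (s * G u)) + β * (G x * (q s * q (G u)))
          ≡⟨ solve 8 (λ α β s S x X u U → α :* (X :* (s :* u)) :+ β :* (x :* (S :* U)) := α :* s :* (X :* u) :+ β :* S :* (x :* U)) refl
               α β s (q s) (G x) (q (G x)) (G u) (q (G u)) ⟩
        α * s * (q (G x) * G u) + β * q s * (G x * q (G u))
          ≡⟨ cong (λ e → α * s * (q (G x) * G u) + e * (G x * q (G u))) αs≡βqs ⟨
        α * s * (q (G x) * G u) + α * s * (G x * q (G u))
          ≡⟨ distribˡ _ _ _ ⟨
        α * s * (G x ⋆ G u) ∎

      αs≢0 : ¬ α * s ≡ 0#
      αs≢0 e = 1≢0 (⋆-integral 1≢0 (f-inj (trans (rel′ 1# 1#)
        (trans (cong (_* (G 1# ⋆ G 1#)) e) (trans (zeroˡ _) (sym (additive-0 f-add)))))))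

      mono = isotopism-monomial f-add G-add G-inj αs≢0 rel′
      i = proj₁ mono
      c = proj₁ (proj₂ mono)
      c″ = proj₁ (proj₂ (proj₂ mono))
      G≡ = proj₁ (proj₂ (proj₂ (proj₂ mono)))
      f≡ = proj₂ (proj₂ (proj₂ (proj₂ mono)))

    -- The two arguments x ^ r v and x v ^ r are decoupled: for a fixed value of
    -- x v ^ r, the value of x ^ r v still depends on v.
    twist-monomial : ∀ {s f A α β i} → m ∤ s +ℕ s → Additive f →
      (∀ x v → f (φ s x * v + A * x * φ s v) ≡ α * φ i (φ s x * v) + β * φ i (x * φ s v)) →
      ∀ z → f z ≡ α * φ i z
    twist-monomial {s} {f} {A} {α} {β} {i} m∤2s f-add rel y = x-y≡0⇒x≡y (begin
      Φ y                                           ≡⟨ cong Φ y≡ ⟩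
      Φ (φ s z * 1# - φ s (z * V ⁻¹) * v₀)          ≡⟨ additive-minus Φ-add _ _ ⟩
      Φ (φ s z * 1#) - Φ (φ s (z * V ⁻¹) * v₀)      ≡⟨ x≡y⇒x-y≡0 (+-cancelʳ (Φ (A * z)) _ _ (trans (rel-Φ z 1# z z≡₁) (sym (rel-Φ (z * V ⁻¹) v₀ z z≡₂)))) ⟩
      0#                                            ∎)
      where
      open ≡-Reasoning
      Φ : Carrier → Carrier
      Φ z = f z - α * φ i z

      Φ-add : Additive Φ
      Φ-add x y = trans (cong₂ (λ a b → a - α * b) (f-add x y) (φ-+ i x y))
        (solve 5 (λ a b α x y → a :+ b :- α :* (x :+ y) := a :- α :* x :+ (b :- α :* y)) refl (f x) (f y) α (φ i x) (φ i y))

      -- The right-hand side depends on w = x v^r alone, so pairs with the same w give the same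
      -- defect Φ (x^r v).
      rel-Φ : ∀ x v w → w ≡ x * φ s v → Φ (φ s x * v) + Φ (A * w) ≡ β * φ i w - α * φ i (A * w)
      rel-Φ x v w refl = begin
        f (φ s x * v) - α * φ i (φ s x * v) + (f (A * (x * φ s v)) - α * φ i (A * (x * φ s v)))
          ≡⟨ solve 5 (λ a b α x y → a :- α :* x :+ (b :- α :* y) := a :+ b :- α :* x :- α :* y) refl
               (f (φ s x * v)) (f (A * (x * φ s v))) α (φ i (φ s x * v)) (φ i (A * (x * φ s v))) ⟩
        f (φ s x * v) + f (A * (x * φ s v)) - α * φ i (φ s x * v) - α * φ i (A * (x * φ s v))
          ≡⟨ cong (λ t → t - α * φ i (φ s x * v) - α * φ i (A * (x * φ s v)))
               (trans (sym (f-add _ _)) (trans (cong (λ t → f (φ s x * v + t)) (sym (*-assoc A x _))) (rel x v))) ⟩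
        α * φ i (φ s x * v) + β * φ i (x * φ s v) - α * φ i (φ s x * v) - α * φ i (A * (x * φ s v))
          ≡⟨ solve 3 (λ a b c → a :+ b :- a :- c := b :- c) refl (α * φ i (φ s x * v)) (β * φ i (x * φ s v)) (α * φ i (A * (x * φ s v))) ⟩
        β * φ i (x * φ s v) - α * φ i (A * (x * φ s v)) ∎

      -- The pairs (z , 1) and (z V⁻¹ , v₀) share the value z of x v^r, while x^r v is z^r for the
      -- first and c z^r for the second. Here c = v₀ / v₀^(r²) differs from 1 because v₀ is moved by
      -- r², so the difference of the two values reaches every y.
      v₀ = proj₁ (moved (s +ℕ s) m∤2s)
      V = φ s v₀
      v₀≢0 : ¬ v₀ ≡ 0#
      v₀≢0 e = proj₂ (moved (s +ℕ s) m∤2s) (trans (cong (φ (s +ℕ s)) e) (trans (φ-0# (s +ℕ s)) (sym e)))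
      V≢0 : ¬ V ≡ 0#
      V≢0 = φ-nonzero s v₀≢0
      c = φ s (V ⁻¹) * v₀
      c≢1 : ¬ 1# - c ≡ 0#
      c≢1 e = proj₂ (moved (s +ℕ s) m∤2s) (begin
        φ (s +ℕ s) v₀                ≡⟨ φ-∘ s s v₀ ⟨
        φ s V                        ≡⟨ *-identityʳ _ ⟨
        φ s V * 1#                   ≡⟨ cong (φ s V *_) (x-y≡0⇒x≡y e) ⟩
        φ s V * (φ s (V ⁻¹) * v₀)    ≡⟨ *-assoc _ _ _ ⟨
        φ s V * φ s (V ⁻¹) * v₀      ≡⟨ cong (_* v₀) (trans (sym (φ-* s V (V ⁻¹))) (trans (cong (φ s) (⁻¹-inverseʳ V≢0)) (φ-1# s))) ⟩
        1# * v₀                      ≡⟨ *-identityˡ v₀ ⟩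
        v₀                           ∎)
      z = proj₁ (φ-surjective s (y * (1# - c) ⁻¹))
      z≡₁ : z ≡ z * φ s 1#
      z≡₁ = sym (trans (cong (z *_) (φ-1# s)) (*-identityʳ z))
      z≡₂ : z ≡ z * V ⁻¹ * V
      z≡₂ = sym (trans (*-assoc _ _ _) (trans (cong (z *_) (⁻¹-inverseˡ V≢0)) (*-identityʳ z)))
      y≡ : y ≡ φ s z * 1# - φ s (z * V ⁻¹) * v₀
      y≡ = sym (begin
        φ s z * 1# - φ s (z * V ⁻¹) * v₀        ≡⟨ cong (λ t → φ s z * 1# - t * v₀) (φ-* s z (V ⁻¹)) ⟩
        φ s z * 1# - φ s z * φ s (V ⁻¹) * v₀    ≡⟨ solve 3 (λ z w v → z :* con (ℤ.+ 1) :- z :* w :* v := z :* (con (ℤ.+ 1) :- w :* v)) refl (φ s z) (φ s (V ⁻¹)) v₀ ⟩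
        φ s z * (1# - c)                        ≡⟨ cong (_* (1# - c)) (proj₂ (φ-surjective s (y * (1# - c) ⁻¹))) ⟩
        y * (1# - c) ⁻¹ * (1# - c)              ≡⟨ *-assoc _ _ _ ⟩
        y * ((1# - c) ⁻¹ * (1# - c))            ≡⟨ cong (y *_) (⁻¹-inverseˡ c≢1) ⟩
        y * 1#                                  ≡⟨ *-identityʳ y ⟩
        y                                       ∎)

    -- From the relations on the axes to monomials.

    module _ {B : Carrier} (B≢0 : ¬ B ≡ 0#) where
      ⋆-lines : ∀ κ κ′ l l′ z w → (κ * z) ⋆ (l * w) + B * ((κ′ * z) ⋆ (l′ * w))
                ≡ (q κ * l + B * q κ′ * l′) * (q z * w) + (κ * q l + B * κ′ * q l′) * (z * q w)
      ⋆-lines κ κ′ l l′ z w rewrite φ-* k κ z | φ-* k κ′ z | φ-* k l w | φ-* k l′ w =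
        solve 13 (λ κ K κ′ K′ l L l′ L′ z Z w W B →
          K :* Z :* (l :* w) :+ κ :* z :* (L :* W) :+ B :* (K′ :* Z :* (l′ :* w) :+ κ′ :* z :* (L′ :* W))
          := (K :* l :+ B :* K′ :* l′) :* (Z :* w) :+ (κ :* L :+ B :* κ′ :* L′) :* (z :* W)) refl
          κ (q κ) κ′ (q κ′) l (q l) l′ (q l′) z (q z) w (q w) B

      -- On two lines the pairing becomes a form with two coefficients in the parameters.
      -- Orthogonality makes both zero; otherwise this is the shape that `autotopism-monomial`
      -- accepts.
      ⋆-aligned : ∀ {a b c d} (al : Aligned a b) (al′ : Aligned c d) →
        let open Aligned al
            open Aligned al′ using () renaming (G to H; κ to l; κ′ to l′) in
        ∀ x v → (a x ⋆ c v) + B * (b x ⋆ d v)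
                ≡ (q κ * l + B * q κ′ * l′) * (q (G x) * H v) + (κ * q l + B * κ′ * q l′) * (G x * q (H v))
      ⋆-aligned al al′ x v = trans
        (cong₂ _+_ (cong₂ _⋆_ (a≡ x) (c≡ v)) (cong (B *_) (cong₂ _⋆_ (b≡ x) (d≡ v))))
        (⋆-lines κ κ′ l l′ (G x) (H v))
        where
        open Aligned al
        open Aligned al′ using () renaming (G to H; κ to l; κ′ to l′; a≡ to c≡; b≡ to d≡)

      orthogonal-lines : ∀ {a b c d} (al : Aligned a b) (al′ : Aligned c d) →
        (∀ x v → (a x ⋆ c v) + B * (b x ⋆ d v) ≡ 0#) →
        let open Aligned al
            open Aligned al′ using () renaming (κ to l; κ′ to l′) in
        q κ * l + B * q κ′ * l′ ≡ 0# × κ * q l + B * κ′ * q l′ ≡ 0#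
      orthogonal-lines al al′ orth = independent₂ s t vanish
        where
        open Aligned al
        open Aligned al′ using () renaming (G to H; κ to l; κ′ to l′; G-surjective to H-surjective)
        s = q κ * l + B * q κ′ * l′
        t = κ * q l + B * κ′ * q l′
        vanish : ∀ w → s * w + t * q w ≡ 0#
        vanish w = let x , Gx≡1 = G-surjective 1# ; v , Hv≡w = H-surjective w in
          trans (unfold Gx≡1 (trans (cong q Gx≡1) (φ-1# k)) Hv≡w (cong q Hv≡w))
            (trans (sym (⋆-aligned al al′ x v)) (orth x v))
          where
          unfold : ∀ {z Z u U} → z ≡ 1# → Z ≡ 1# → u ≡ w → U ≡ q w →
                   s * w + t * q w ≡ s * (Z * u) + t * (z * U)
          unfold refl refl refl refl = cong₂ (λ a b → s * a + t * b) (sym (*-identityˡ _)) (sym (*-identityˡ _))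

      -- The row (s , t) annihilates (b , d). If it annihilated the independent vector (a , c) as
      -- well, Cramer's rule would make it zero.
      pairing-nonzero : ∀ {s t a b c d} → ¬ (s ≡ 0# × t ≡ 0#) → s * b + t * d ≡ 0# → ¬ a * d ≡ b * c →
                        ¬ s * a + t * c ≡ 0#
      pairing-nonzero {s} {t} {a} {b} {c} {d} st≢0 orth det≢0 e = st≢0
        ( integral Δ≢0 (trans (solve 6 (λ s t a b c d → (a :* d :- b :* c) :* s := (s :* a :+ t :* c) :* d :- (s :* b :+ t :* d) :* c) refl s t a b c d)
            (zero-combination e orth))
        , integral Δ≢0 (trans (solve 6 (λ s t a b c d → (a :* d :- b :* c) :* t := (s :* b :+ t :* d) :* a :- (s :* a :+ t :* c) :* b) refl s t a b c d)
            (zero-combination orth e)))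
        where
        Δ≢0 : ¬ a * d - b * c ≡ 0#
        Δ≢0 = det≢0 ∘ x-y≡0⇒x≡y
        zero-combination : ∀ {x y u v} → x ≡ 0# → y ≡ 0# → x * u - y * v ≡ 0#
        zero-combination {u = u} {v} refl refl = x≡y⇒x-y≡0 (trans (zeroˡ u) (sym (zeroˡ v)))

      -- The line of (c′ , d′) is orthogonal to that of (a , b), and `rank` makes the line of (c ,
      -- d) independent of it. So the pairing of (a , b) with (c , d) has two nonzero coefficients.
      half : ∀ {f a b c d c′ d′} → Additive f → Injective _≡_ _≡_ f → (∀ x → a x ≡ 0# → b x ≡ 0# → x ≡ 0#) →
        ((al , _) : AlignedAdditive a b) (al₁ : Aligned c d) (al₂ : Aligned c′ d′) →
        ¬ Aligned.κ al₁ * Aligned.κ′ al₂ ≡ Aligned.κ al₂ * Aligned.κ′ al₁ →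
        (∀ x v → (a x ⋆ c′ v) + B * (b x ⋆ d′ v) ≡ 0#) →
        (∀ x u → f (x ⋆ u) ≡ (a x ⋆ c u) + B * (b x ⋆ d u)) →
        ∃[ i ] ∃[ s ] ∃[ s′ ] ∃[ s″ ]
          ((∀ x → Aligned.G al x ≡ s * φ i x) × (∀ x → Aligned.G al₁ x ≡ s′ * φ i x) × (∀ x → f x ≡ s″ * φ i x))
      half {a = a} {b} f-add f-inj ker (al , G-add) al₁ al₂ rank orth rel =
        autotopism-monomial f-add f-inj G-add G-injective
          (pairing-nonzero (λ (e , e′) → κ-nonzero (φ-≡0 k e) (φ-≡0 k (integral B≢0 e′)))
            (proj₁ (orthogonal-lines al al₂ orth)) rank)
          (pairing-nonzero (λ (e , e′) → κ-nonzero e (integral B≢0 e′))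
            (proj₂ (orthogonal-lines al al₂ orth))
            -- The second coefficient involves the q-images of the directions; their determinant is
            -- the q-image of the original one.
            (λ e → rank (φ-injective k (trans (φ-* k _ _) (trans e (sym (φ-* k _ _)))))))
          (λ x u → trans (rel x u) (⋆-aligned al al₁ x u))
        where
        open Aligned al
        κ-nonzero : κ ≡ 0# → ¬ κ′ ≡ 0#
        κ-nonzero e e′ = 1≢0 (ker 1# (vanish (a≡ 1#) e) (vanish (b≡ 1#) e′))
          where
          vanish : ∀ {x c y} → x ≡ c * y → c ≡ 0# → x ≡ 0#
          vanish {y = y} e refl = trans e (zeroˡ y)

      module _ {s : ℕ} (m∤2s : m ∤ s +ℕ s) {A : Carrier} {f₁ f₄ g₁ g₂ g₃ g₄ h₁ h₂ h₃ h₄ : Carrier → Carrier}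
        (f₁-add : Additive f₁) (f₄-add : Additive f₄) (f₁-inj : Injective _≡_ _≡_ f₁)
        (g₁-add : Additive g₁) (g₂-add : Additive g₂) (g₃-add : Additive g₃) (g₄-add : Additive g₄)
        (rel₁₁ : ∀ x u → f₁ (x ⋆ u) ≡ (g₁ x ⋆ h₁ u) + B * (g₃ x ⋆ h₃ u))
        (rel₁₂ : ∀ x v → (g₁ x ⋆ h₂ v) + B * (g₃ x ⋆ h₄ v) ≡ 0#)
        (rel₂₁ : ∀ y u → (g₂ y ⋆ h₁ u) + B * (g₄ y ⋆ h₃ u) ≡ 0#)
        (rel₂₂ : ∀ y v → f₁ (B * (y ⋆ v)) ≡ (g₂ y ⋆ h₂ v) + B * (g₄ y ⋆ h₄ v))
        (rel₄ : ∀ x v → f₄ (φ s x * v + A * x * φ s v)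
                        ≡ φ s (g₁ x) * h₄ v + A * g₁ x * φ s (h₄ v) + A * φ s (g₃ x) * h₂ v + g₃ x * φ s (h₂ v)) where

        -- Absorbing the factor B into the map makes the second axis an instance of the same lemma
        -- as the first.
        f₁B : Carrier → Carrier
        f₁B z = f₁ (B * z)

        f₁B-add : Additive f₁B
        f₁B-add x y = trans (cong f₁ (distribˡ B x y)) (f₁-add _ _)

        f₁B-inj : Injective _≡_ _≡_ f₁B
        f₁B-inj = *-cancelˡ B≢0 ∘ f₁-inj

        ⋆-zero-pair : ∀ {x y} u v → x ≡ 0# → y ≡ 0# → (x ⋆ u) + B * (y ⋆ v) ≡ 0#
        ⋆-zero-pair u v refl refl = trans (cong₂ (λ s t → s + B * t) (⋆-zeroˡ u) (⋆-zeroˡ v))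
          (trans (+-identityˡ _) (zeroʳ B))

        kernel : ∀ {f} → Additive f → Injective _≡_ _≡_ f → ∀ {x} → f x ≡ 0# → x ≡ 0#
        kernel f-add f-inj e = f-inj (trans e (sym (additive-0 f-add)))

        g₁₃-ker : ∀ x → g₁ x ≡ 0# → g₃ x ≡ 0# → x ≡ 0#
        g₁₃-ker x e e′ = ⋆-integral 1≢0 (kernel f₁-add f₁-inj (trans (rel₁₁ x 1#) (⋆-zero-pair _ _ e e′)))

        g₂₄-ker : ∀ y → g₂ y ≡ 0# → g₄ y ≡ 0# → y ≡ 0#
        g₂₄-ker y e e′ = ⋆-integral 1≢0 (kernel f₁B-add f₁B-inj (trans (rel₂₂ y 1#) (⋆-zero-pair _ _ e e′)))

        h₁₃-inj : ∀ u v → h₁ u ≡ h₁ v → h₃ u ≡ h₃ v → u ≡ v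
        h₁₃-inj u v e e′ = 1⋆-injective (f₁-inj (trans (rel₁₁ 1# u)
          (trans (cong₂ (λ s t → (g₁ 1# ⋆ s) + B * (g₃ 1# ⋆ t)) e e′) (sym (rel₁₁ 1# v)))))

        h₂₄-inj : ∀ u v → h₂ u ≡ h₂ v → h₄ u ≡ h₄ v → u ≡ v
        h₂₄-inj u v e e′ = 1⋆-injective (f₁B-inj (trans (rel₂₂ 1# u)
          (trans (cong₂ (λ s t → (g₂ 1# ⋆ s) + B * (g₄ 1# ⋆ t)) e e′) (sym (rel₂₂ 1# v)))))

        combine : ∀ x y s s′ t t′ → (x ⋆ s) + B * (y ⋆ t) + ((x ⋆ s′) + B * (y ⋆ t′))
                  ≡ (x ⋆ (s + s′)) + B * (y ⋆ (t + t′))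
        combine x y s s′ t t′ = trans
          (solve 5 (λ a b B c d → a :+ B :* b :+ (c :+ B :* d) := a :+ c :+ B :* (b :+ d)) refl
            (x ⋆ s) (y ⋆ t) B (x ⋆ s′) (y ⋆ t′))
          (sym (cong₂ (λ a b → a + B * b) (⋆-distribˡ x s s′) (⋆-distribˡ y t t′)))

        ⋆-zero-pairʳ : ∀ x y {s t} → s ≡ 0# → t ≡ 0# → (x ⋆ s) + B * (y ⋆ t) ≡ 0#
        ⋆-zero-pairʳ x y refl refl = trans (cong₂ (λ s t → s + B * t) (⋆-zeroʳ x) (⋆-zeroʳ y))
          (trans (+-identityˡ _) (zeroʳ B))

        -- By orthogonality the contribution of h₂ v, h₄ v may be added to the relation for u at x =
        -- 1 for free. The sums then vanish, leaving f₁ (1 ⋆ u) = 0.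
        h-ker₁ : ∀ u v → h₁ u + h₂ v ≡ 0# → h₃ u + h₄ v ≡ 0# → u ≡ 0#
        h-ker₁ u v e e′ = ⋆-integral 1≢0 (trans (⋆-comm u 1#) (kernel f₁-add f₁-inj (trans (rel₁₁ 1# u) (begin
          (g₁ 1# ⋆ h₁ u) + B * (g₃ 1# ⋆ h₃ u)                        ≡⟨ +-identityʳ _ ⟨
          (g₁ 1# ⋆ h₁ u) + B * (g₃ 1# ⋆ h₃ u) + 0#
            ≡⟨ cong ((g₁ 1# ⋆ h₁ u) + B * (g₃ 1# ⋆ h₃ u) +_) (rel₁₂ 1# v) ⟨
          (g₁ 1# ⋆ h₁ u) + B * (g₃ 1# ⋆ h₃ u) + ((g₁ 1# ⋆ h₂ v) + B * (g₃ 1# ⋆ h₄ v))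
            ≡⟨ combine (g₁ 1#) (g₃ 1#) (h₁ u) (h₂ v) (h₃ u) (h₄ v) ⟩
          (g₁ 1# ⋆ (h₁ u + h₂ v)) + B * (g₃ 1# ⋆ (h₃ u + h₄ v))      ≡⟨ ⋆-zero-pairʳ _ _ e e′ ⟩
          0#                                                         ∎))))
          where open ≡-Reasoning

        h-ker₂ : ∀ u v → h₁ u + h₂ v ≡ 0# → h₃ u + h₄ v ≡ 0# → v ≡ 0#
        h-ker₂ u v e e′ = ⋆-integral 1≢0 (trans (⋆-comm v 1#) (kernel f₁B-add f₁B-inj (trans (rel₂₂ 1# v) (begin
          (g₂ 1# ⋆ h₂ v) + B * (g₄ 1# ⋆ h₄ v)                        ≡⟨ +-identityˡ _ ⟨
          0# + ((g₂ 1# ⋆ h₂ v) + B * (g₄ 1# ⋆ h₄ v))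
            ≡⟨ cong (_+ ((g₂ 1# ⋆ h₂ v) + B * (g₄ 1# ⋆ h₄ v))) (rel₂₁ 1# u) ⟨
          (g₂ 1# ⋆ h₁ u) + B * (g₄ 1# ⋆ h₃ u) + ((g₂ 1# ⋆ h₂ v) + B * (g₄ 1# ⋆ h₄ v))
            ≡⟨ combine (g₂ 1#) (g₄ 1#) (h₁ u) (h₂ v) (h₃ u) (h₄ v) ⟩
          (g₂ 1# ⋆ (h₁ u + h₂ v)) + B * (g₄ 1# ⋆ (h₃ u + h₄ v))      ≡⟨ ⋆-zero-pairʳ _ _ e e′ ⟩
          0#                                                         ∎))))
          where open ≡-Reasoning

        aligned₁ = aligned g₁-add g₃-add g₁₃-ker h₂₄-inj B≢0 rel₁₂
        aligned₂ = aligned g₂-add g₄-add g₂₄-ker h₁₃-inj B≢0 rel₂₁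
        module G₁₃ = Aligned (proj₁ (proj₁ aligned₁))
        module G₂₄ = Aligned (proj₁ (proj₁ aligned₂))
        module H₁₃ = Aligned (proj₂ aligned₂)
        module H₂₄ = Aligned (proj₂ aligned₁)
        λ₁ = H₁₃.κ
        λ₂ = H₂₄.κ
        λ₃ = H₁₃.κ′
        λ₄ = H₂₄.κ′

        -- A solution (X , Y) has preimages (u , v) under the parameters, and these are 0. The
        -- parameters are bijections whose value at 0 is not known beforehand; applying the same
        -- argument to the zero solution shows that value to be 0.
        λ-ker : ∀ X Y → λ₁ * X + λ₂ * Y ≡ 0# → λ₃ * X + λ₄ * Y ≡ 0# → X ≡ 0# × Y ≡ 0#
        λ-ker X Y e e′ = let u , Hu≡X , v , Hv≡Y , u≡0 , v≡0 = preimages X Y e e′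
                             u₀ , Hu₀≡0 , v₀ , Hv₀≡0 , u₀≡0 , v₀≡0 = preimages 0# 0# 0≡0 0≡0 in
          trans (sym Hu≡X) (trans (cong H₁₃.G (trans u≡0 (sym u₀≡0))) Hu₀≡0) ,
          trans (sym Hv≡Y) (trans (cong H₂₄.G (trans v≡0 (sym v₀≡0))) Hv₀≡0)
          where
          0≡0 : ∀ {a b} → a * 0# + b * 0# ≡ 0#
          0≡0 = trans (cong₂ _+_ (zeroʳ _) (zeroʳ _)) (+-identityˡ 0#)
          preimages : ∀ X Y → λ₁ * X + λ₂ * Y ≡ 0# → λ₃ * X + λ₄ * Y ≡ 0# →
                      ∃[ u ] (H₁₃.G u ≡ X × ∃[ v ] (H₂₄.G v ≡ Y × u ≡ 0# × v ≡ 0#))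
          preimages X Y e e′ = u , Hu≡X , v , Hv≡Y , h-ker₁ u v sum₁ sum₂ , h-ker₂ u v sum₁ sum₂
            where
            u = proj₁ (H₁₃.G-surjective X)
            Hu≡X = proj₂ (H₁₃.G-surjective X)
            v = proj₁ (H₂₄.G-surjective Y)
            Hv≡Y = proj₂ (H₂₄.G-surjective Y)
            sum₁ : h₁ u + h₂ v ≡ 0#
            sum₁ = trans (cong₂ _+_ (trans (H₁₃.a≡ u) (cong (λ₁ *_) Hu≡X)) (trans (H₂₄.a≡ v) (cong (λ₂ *_) Hv≡Y))) e
            sum₂ : h₃ u + h₄ v ≡ 0#
            sum₂ = trans (cong₂ _+_ (trans (H₁₃.b≡ u) (cong (λ₃ *_) Hu≡X)) (trans (H₂₄.b≡ v) (cong (λ₄ *_) Hv≡Y))) e′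

        -- A vanishing determinant would make (λ₄ , -λ₃) and (λ₂ , -λ₁) solutions of the system, so
        -- all four entries would be 0, and then (1 , 1) would be a nonzero solution.
        rank : ¬ λ₁ * λ₄ ≡ λ₂ * λ₃
        rank e = 1≢0 (proj₁ (λ-ker 1# 1# (zeros λ₁≡0 λ₂≡0) (zeros λ₃≡0 λ₄≡0)))
          where
          move : ∀ {a b c d} → a * b ≡ c * d → a * b + c * - d ≡ 0#
          move {a} {b} {c} {d} e = trans (cong (a * b +_) (sym (-‿distribʳ-* c d))) (x≡y⇒x-y≡0 e)
          first = λ-ker λ₄ (- λ₃) (move e) (move (*-comm λ₃ λ₄))
          second = λ-ker λ₂ (- λ₁) (move (*-comm λ₁ λ₂)) (move (trans (*-comm λ₃ λ₂) (trans (sym e) (*-comm λ₁ λ₄))))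
          neg≡0 : ∀ {x} → - x ≡ 0# → x ≡ 0#
          neg≡0 {x} e = trans (sym (-‿involutive x)) (trans (cong -_ e) -0#≈0#)
          λ₄≡0 = proj₁ first
          λ₃≡0 = neg≡0 (proj₂ first)
          λ₂≡0 = proj₁ second
          λ₁≡0 = neg≡0 (proj₂ second)
          zeros : ∀ {a b} → a ≡ 0# → b ≡ 0# → a * 1# + b * 1# ≡ 0#
          zeros refl refl = trans (cong₂ _+_ (zeroˡ _) (zeroˡ _)) (+-identityˡ 0#)

        monomial-G₁₃ = half f₁-add f₁-inj g₁₃-ker (proj₁ aligned₁) (proj₂ aligned₂) (proj₂ aligned₁) rank rel₁₂ rel₁₁
        monomial-G₂₄ = half f₁B-add f₁B-inj g₂₄-ker (proj₁ aligned₂) (proj₂ aligned₁) (proj₂ aligned₂)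
          (λ e → rank (sym e)) rel₂₁ rel₂₂

        conclusion : IsMonomial p f₁ × IsMonomial p f₄ ×
                     IsMonomial p g₁ × IsMonomial p g₂ × IsMonomial p g₃ × IsMonomial p g₄
        conclusion = assemble monomial-G₁₃ monomial-G₂₄
          where
          multiple : ∀ i {a G : Carrier → Carrier} {κ c} → (∀ x → a x ≡ κ * G x) → (∀ x → G x ≡ c * φ i x) →
                     ∀ x → a x ≡ κ * c * φ i x
          multiple i {κ = κ} a≡ G≡ x = trans (a≡ x) (trans (cong (κ *_) (G≡ x)) (sym (*-assoc _ _ _)))

          -- Both halves describe f₁ (B z), as c φᵢ(B) φᵢ(z) and as c′ φⱼ(z); the value at z = 1
          -- identifies the constants. The conclusion is about maps, since exponents matter only
          -- modulo m.
          same-exponent : ∀ i j {c c′} → (∀ z → f₁ z ≡ c * φ i z) → (∀ z → f₁B z ≡ c′ * φ j z) → ∀ z → φ i z ≡ φ j z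
          same-exponent i j {c} {c′} f₁≡ f₁B≡ z = *-cancelˡ c′≢0 (begin
            c′ * φ i z               ≡⟨ cong (_* φ i z) c′≡ ⟩
            c * φ i B * φ i z        ≡⟨ *-assoc _ _ _ ⟩
            c * (φ i B * φ i z)      ≡⟨ cong (c *_) (φ-* i B z) ⟨
            c * φ i (B * z)          ≡⟨ f₁≡ (B * z) ⟨
            f₁ (B * z)               ≡⟨ f₁B≡ z ⟩
            c′ * φ j z               ∎)
            where
            open ≡-Reasoning
            c′≡f₁B1 : c′ ≡ f₁B 1#
            c′≡f₁B1 = sym (trans (f₁B≡ 1#) (trans (cong (c′ *_) (φ-1# j)) (*-identityʳ c′)))
            c′≢0 : ¬ c′ ≡ 0#
            c′≢0 e = 1≢0 (kernel f₁B-add f₁B-inj (trans (sym c′≡f₁B1) e))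
            c′≡ : c′ ≡ c * φ i B
            c′≡ = trans c′≡f₁B1 (trans (cong f₁ (*-identityʳ B)) (f₁≡ B))

          f₄-form : ∀ i {a₁ a₃ b₂ b₄} → (∀ x → g₁ x ≡ a₁ * φ i x) → (∀ x → g₃ x ≡ a₃ * φ i x) →
            (∀ v → h₂ v ≡ b₂ * φ i v) → (∀ v → h₄ v ≡ b₄ * φ i v) →
            ∀ x v → f₄ (φ s x * v + A * x * φ s v)
                    ≡ (φ s a₁ * b₄ + A * φ s a₃ * b₂) * φ i (φ s x * v) + (A * a₁ * φ s b₄ + a₃ * φ s b₂) * φ i (x * φ s v)
          f₄-form i {a₁} {a₃} {b₂} {b₄} g₁≡ g₃≡ h₂≡ h₄≡ x v = trans (rel₄ x v) (expand
            (g₁≡ x) (φ-image (g₁≡ x)) (g₃≡ x) (φ-image (g₃≡ x)) (h₂≡ v) (φ-image (h₂≡ v)) (h₄≡ v) (φ-image (h₄≡ v))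
            (trans (φ-* i (φ s x) v) (cong (_* φ i v) (φ-comm x))) (trans (φ-* i x (φ s v)) (cong (φ i x *_) (φ-comm v))))
            where
            φ-comm : ∀ x → φ i (φ s x) ≡ φ s (φ i x)
            φ-comm x = trans (φ-∘ i s x) (trans (cong (λ j → φ j x) (ℕ.+-comm i s)) (sym (φ-∘ s i x)))
            φ-image : ∀ {y c z} → y ≡ c * z → φ s y ≡ φ s c * φ s z
            φ-image {c = c} {z} e = trans (cong (φ s) e) (φ-* s c z)
            expand : ∀ {x X v V g G g′ G′ h H h′ H′ A₁ A₃ B₂ B₄ t t′} →
              g ≡ a₁ * x → G ≡ A₁ * X → g′ ≡ a₃ * x → G′ ≡ A₃ * X →
              h ≡ b₂ * v → H ≡ B₂ * V → h′ ≡ b₄ * v → H′ ≡ B₄ * V → t ≡ X * v → t′ ≡ x * V →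
              G * h′ + A * g * H′ + A * G′ * h + g′ * H ≡ (A₁ * b₄ + A * A₃ * b₂) * t + (A * a₁ * B₄ + a₃ * B₂) * t′
            expand {x} {X} {v} {V} {A₁ = A₁} {A₃} {B₂} {B₄} refl refl refl refl refl refl refl refl refl refl =
              solve 13 (λ A a₁ a₃ b₂ b₄ A₁ A₃ B₂ B₄ x X v V →
                A₁ :* X :* (b₄ :* v) :+ A :* (a₁ :* x) :* (B₄ :* V) :+ A :* (A₃ :* X) :* (b₂ :* v) :+ a₃ :* x :* (B₂ :* V)
                := (A₁ :* b₄ :+ A :* A₃ :* b₂) :* (X :* v) :+ (A :* a₁ :* B₄ :+ a₃ :* B₂) :* (x :* V)) refl
                A a₁ a₃ b₂ b₄ A₁ A₃ B₂ B₄ x X v V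

          assemble : (∃[ i ] ∃[ c ] ∃[ c′ ] ∃[ c″ ]
              ((∀ x → G₁₃.G x ≡ c * φ i x) × (∀ x → H₁₃.G x ≡ c′ * φ i x) × (∀ x → f₁ x ≡ c″ * φ i x))) →
            (∃[ j ] ∃[ c ] ∃[ c′ ] ∃[ c″ ]
              ((∀ x → G₂₄.G x ≡ c * φ j x) × (∀ x → H₂₄.G x ≡ c′ * φ j x) × (∀ x → f₁B x ≡ c″ * φ j x))) →
            IsMonomial p f₁ × IsMonomial p f₄ ×
            IsMonomial p g₁ × IsMonomial p g₂ × IsMonomial p g₃ × IsMonomial p g₄
          assemble (i , c , _ , c″ , G≡ , _ , f₁≡) (j , d , d′ , _ , G′≡ , H≡ , f₁B≡) =
            (_ , i , f₁≡) ,
            (_ , i , twist-monomial {s} {i = i} m∤2s f₄-add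
              (f₄-form i g₁≡ g₃≡ (multiple i H₂₄.a≡ H≡′) (multiple i H₂₄.b≡ H≡′))) ,
            (_ , i , g₁≡) , (_ , j , multiple j G₂₄.a≡ G′≡) , (_ , i , g₃≡) , (_ , j , multiple j G₂₄.b≡ G′≡)
            where
            g₁≡ = multiple i G₁₃.a≡ G≡
            g₃≡ = multiple i G₁₃.b≡ G≡
            -- The second half delivers h₂ and h₄ with exponent j, but the relation for f₄
            -- multiplies them with g₁ and g₃ of exponent i.
            H≡′ : ∀ x → H₂₄.G x ≡ d′ * φ i x
            H≡′ x = trans (H≡ x) (cong (d′ *_) (sym (same-exponent i j f₁≡ f₁B≡ x)))

    -- Reading the relations off an automorphism.

    monomials : ∀ {s A B} → m ∤ s +ℕ s → ¬ B ≡ 0# → ∀ {f₁ f₂ f₃ f₄ g₁ g₂ g₃ g₄} →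
      Additive f₁ → Additive f₄ → Additive g₁ → Additive g₂ → Additive g₃ → Additive g₄ →
      InAut (p ^ℕ k) (p ^ℕ s) A B (block f₁ f₂ f₃ f₄) (block g₁ g₂ g₃ g₄) →
      (∀ y → f₂ y ≡ 0#) → (∀ x → f₃ x ≡ 0#) →
      IsMonomial p f₁ × IsMonomial p f₄ ×
      IsMonomial p g₁ × IsMonomial p g₂ × IsMonomial p g₃ × IsMonomial p g₄
    monomials {s} {A} {B} m∤2s B≢0 {f₁} {f₂} {f₃} {f₄} {g₁} {g₂} {g₃} {g₄}
      f₁-add f₄-add g₁-add g₂-add g₃-add g₄-add (_ , (X⁻¹ , X⁻¹X , _) , _ , _ , image) f₂≡0 f₃≡0 =
      conclusion B≢0 {s} m∤2s {A} {f₁} {f₄} {g₁} {g₂} {g₃} {g₄} {h₁} {h₂} {h₃} {h₄}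
        f₁-add f₄-add f₁-inj g₁-add g₂-add g₃-add g₄-add rel₁₁ rel₁₂ rel₂₁ rel₂₂ rel₄
      where
      open ≡-Reasoning

      r : Carrier → Carrier
      r = φ s

      -- The existence statement read as a choice function of (u , v); it says nothing about sums.
      W T : Carrier → Carrier → Carrier
      W u v = proj₁ (image u v)
      T u v = proj₁ (proj₂ (image u v))

      h₁ h₂ h₃ h₄ : Carrier → Carrier
      h₁ u = W u 0#
      h₂ v = W 0# v
      h₃ u = T u 0#
      h₄ v = T 0# v

      f₁-inj : Injective _≡_ _≡_ f₁
      f₁-inj {x} {y} e = cong proj₁ (trans (sym (X⁻¹X (x , 0#)))
        (trans (cong X⁻¹ (cong₂ _,_ (cong (_+ f₂ 0#) e) (cong (_+ f₄ 0#) (trans (f₃≡0 x) (sym (f₃≡0 y))))))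
          (X⁻¹X (y , 0#))))

      first : ∀ u v x y → f₁ ((x ⋆ u) + B * (y ⋆ v)) ≡ ((g₁ x + g₂ y) ⋆ W u v) + B * ((g₃ x + g₄ y) ⋆ T u v)
      first u v x y = trans (sym (trans (cong (f₁ ((x ⋆ u) + B * (y ⋆ v)) +_) (f₂≡0 _)) (+-identityʳ _)))
        (cong proj₁ (proj₂ (proj₂ (image u v)) (x , y)))

      second : ∀ u v x y → f₄ (r x * v + A * x * r v + A * r y * u + y * r u)
        ≡ r (g₁ x + g₂ y) * T u v + A * (g₁ x + g₂ y) * r (T u v) + A * r (g₃ x + g₄ y) * W u v + (g₃ x + g₄ y) * r (W u v)
      second u v x y = trans (sym (trans (cong (_+ f₄ (r x * v + A * x * r v + A * r y * u + y * r u)) (f₃≡0 _)) (+-identityˡ _)))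
        (cong proj₂ (proj₂ (proj₂ (image u v)) (x , y)))

      on-first-axis : ∀ {g g′ x} → Additive g′ → g x + g′ 0# ≡ g x
      on-first-axis {g} {x = x} g′-add = trans (cong (g x +_) (additive-0 g′-add)) (+-identityʳ _)

      on-second-axis : ∀ {g g′ y} → Additive g → g 0# + g′ y ≡ g′ y
      on-second-axis {g′ = g′} {y} g-add = trans (cong (_+ g′ y) (additive-0 g-add)) (+-identityˡ _)

      x-axis : ∀ u v x → f₁ (x ⋆ u) ≡ (g₁ x ⋆ W u v) + B * (g₃ x ⋆ T u v)
      x-axis u v x = begin
        f₁ (x ⋆ u)                       ≡⟨ cong f₁ (trans (cong (λ t → x ⋆ u + B * t) (⋆-zeroˡ v))
                                              (trans (cong (x ⋆ u +_) (zeroʳ B)) (+-identityʳ _))) ⟨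
        f₁ ((x ⋆ u) + B * (0# ⋆ v))      ≡⟨ first u v x 0# ⟩
        ((g₁ x + g₂ 0#) ⋆ W u v) + B * ((g₃ x + g₄ 0#) ⋆ T u v)
          ≡⟨ cong₂ (λ s t → (s ⋆ W u v) + B * (t ⋆ T u v)) (on-first-axis {g₁} g₂-add) (on-first-axis {g₃} g₄-add) ⟩
        (g₁ x ⋆ W u v) + B * (g₃ x ⋆ T u v) ∎

      y-axis : ∀ u v y → f₁ (B * (y ⋆ v)) ≡ (g₂ y ⋆ W u v) + B * (g₄ y ⋆ T u v)
      y-axis u v y = begin
        f₁ (B * (y ⋆ v))                 ≡⟨ cong f₁ (trans (cong (_+ B * (y ⋆ v)) (⋆-zeroˡ u)) (+-identityˡ _)) ⟨
        f₁ ((0# ⋆ u) + B * (y ⋆ v))      ≡⟨ first u v 0# y ⟩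
        ((g₁ 0# + g₂ y) ⋆ W u v) + B * ((g₃ 0# + g₄ y) ⋆ T u v)
          ≡⟨ cong₂ (λ s t → (s ⋆ W u v) + B * (t ⋆ T u v)) (on-second-axis {g′ = g₂} g₁-add) (on-second-axis {g′ = g₄} g₃-add) ⟩
        (g₂ y ⋆ W u v) + B * (g₄ y ⋆ T u v) ∎

      rel₁₁ : ∀ x u → f₁ (x ⋆ u) ≡ (g₁ x ⋆ h₁ u) + B * (g₃ x ⋆ h₃ u)
      rel₁₁ x u = x-axis u 0# x

      rel₁₂ : ∀ x v → (g₁ x ⋆ h₂ v) + B * (g₃ x ⋆ h₄ v) ≡ 0#
      rel₁₂ x v = trans (sym (x-axis 0# v x)) (trans (cong f₁ (⋆-zeroʳ x)) (additive-0 f₁-add))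

      rel₂₁ : ∀ y u → (g₂ y ⋆ h₁ u) + B * (g₄ y ⋆ h₃ u) ≡ 0#
      rel₂₁ y u = trans (sym (y-axis u 0# y))
        (trans (cong f₁ (trans (cong (B *_) (⋆-zeroʳ y)) (zeroʳ B))) (additive-0 f₁-add))

      rel₂₂ : ∀ y v → f₁ (B * (y ⋆ v)) ≡ (g₂ y ⋆ h₂ v) + B * (g₄ y ⋆ h₄ v)
      rel₂₂ y v = y-axis 0# v y

      rel₄ : ∀ x v → f₄ (r x * v + A * x * r v)
             ≡ r (g₁ x) * h₄ v + A * g₁ x * r (h₄ v) + A * r (g₃ x) * h₂ v + g₃ x * r (h₂ v)
      rel₄ x v = begin
        f₄ (r x * v + A * x * r v)
          ≡⟨ cong f₄ (trans (cong₂ _+_ (trans (cong (r x * v + A * x * r v +_) (zeroʳ _)) (+-identityʳ _)) (zeroˡ _)) (+-identityʳ _)) ⟨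
        f₄ (r x * v + A * x * r v + A * r 0# * 0# + 0# * r 0#)
          ≡⟨ second 0# v x 0# ⟩
        r (g₁ x + g₂ 0#) * h₄ v + A * (g₁ x + g₂ 0#) * r (h₄ v) + A * r (g₃ x + g₄ 0#) * h₂ v + (g₃ x + g₄ 0#) * r (h₂ v)
          ≡⟨ cong₂ (λ s t → r s * h₄ v + A * s * r (h₄ v) + A * r t * h₂ v + t * r (h₂ v))
               (on-first-axis {g₁} g₂-add) (on-first-axis {g₃} g₄-add) ⟩
        r (g₁ x) * h₄ v + A * g₁ x * r (h₄ v) + A * r (g₃ x) * h₂ v + g₃ x * r (h₂ v) ∎

-- Divisibility of the exponents by m.

module Exponents (h k : ℕ) (1≤k : 1 ≤ k) (k≤ : k ≤ 2 *ℕ h ∸ 1)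
  (odd-quotient : ∃[ o ] (2 *ℕ h ≡ o *ℕ gcd k (2 *ℕ h) × o % 2 ≡ 1)) where
  private
    m = 2 *ℕ h

  o : ℕ
  o = proj₁ odd-quotient

  k<m : k < m
  k<m = ℕ.≤-<-trans k≤ (m∸1<m (ℕ.≤-trans 1≤k (ℕ.≤-trans k≤ (ℕ.m∸n≤m m 1))))
    where
    m∸1<m : ∀ {m} → 0 < m → m ∸ 1 < m
    m∸1<m {suc m} _ = ℕ.≤-refl

  0<m : 0 < m
  0<m = ℕ.≤-trans (s≤s z≤n) k<m

  o≡ : o ≡ 1 +ℕ (o / 2) *ℕ 2
  o≡ = trans (m≡m%n+[m/n]*n o 2) (cong (_+ℕ (o / 2) *ℕ 2) (proj₂ (proj₂ odd-quotient)))

  o*≡ : ∀ j → o *ℕ j ≡ (o / 2) *ℕ (j +ℕ j) +ℕ j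
  o*≡ j = trans (cong (_*ℕ j) o≡)
    (ℕS.solve 2 (λ t j → (ℕS.con 1 ℕS.:+ t ℕS.:* ℕS.con 2) ℕS.:* j ℕS.:= t ℕS.:* (j ℕS.:+ j) ℕS.:+ j) refl (o / 2) j)

  m∣ok : m ∣ o *ℕ k
  m∣ok with gcd[m,n]∣m k m
  ... | divides k′ k≡ = divides k′ (begin
    o *ℕ k                  ≡⟨ cong (o *ℕ_) k≡ ⟩
    o *ℕ (k′ *ℕ gcd k m)    ≡⟨ ℕS.solve 3 (λ o k e → o ℕS.:* (k ℕS.:* e) ℕS.:= k ℕS.:* (o ℕS.:* e)) refl o k′ (gcd k m) ⟩
    k′ *ℕ (o *ℕ gcd k m)    ≡⟨ cong (k′ *ℕ_) (proj₁ (proj₂ odd-quotient)) ⟨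
    k′ *ℕ m                 ∎)
    where open ≡-Reasoning

  -- As o is odd, o j is a multiple of 2j plus j.
  halve : ∀ j → m ∣ o *ℕ j → m ∣ j +ℕ j → m ∣ j
  halve j m∣oj m∣2j = ∣m+n∣m⇒∣n (subst (m ∣_) (o*≡ j) m∣oj) (∣n⇒∣m*n (o / 2) m∣2j)

  m∤k : m ∤ k
  m∤k m∣k = ℕ.<⇒≱ k<m (∣⇒≤ {{ℕ.>-nonZero 1≤k}} m∣k)

  m∤2k : m ∤ k +ℕ k
  m∤2k m∣2k = m∤k (halve k m∣ok m∣2k)

  m∤4k : m ∤ (k +ℕ k) +ℕ (k +ℕ k)
  m∤4k m∣4k = m∤2k (halve (k +ℕ k)
    (subst (m ∣_) (sym (ℕ.*-distribˡ-+ o k k)) (∣m∣n⇒∣m+n m∣ok m∣ok)) m∣4k)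

  -- Since m = 2h, doubling k + h gives 2k modulo m.
  m∤2[k+h] : m ∤ (k +ℕ h) +ℕ (k +ℕ h)
  m∤2[k+h] m∣ = m∤2k (∣m+n∣m⇒∣n (subst (m ∣_)
    (ℕS.solve 2 (λ k h → (k ℕS.:+ h) ℕS.:+ (k ℕS.:+ h) ℕS.:= ℕS.con 2 ℕS.:* h ℕS.:+ (k ℕS.:+ k)) refl k h) m∣) ∣-refl)

theorem4p9 : (p h k : ℕ) → Prime p → p % 2 ≡ 1 →
    1 ≤ k → k ≤ 2 *ℕ h ∸ 1 →
    (∃[ o ] (2 *ℕ h ≡ o *ℕ gcd k (2 *ℕ h) × o % 2 ≡ 1)) →
    (F : FiniteField (p ^ℕ (2 *ℕ h))) →
    let open FiniteField F
        open FieldNotions F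
        m = 2 *ℕ h
        Q = p ^ℕ h
        q = p ^ℕ k
        r = p ^ℕ (k +ℕ h)
        e = gcd k m
        d = gcd (k +ℕ h) m
    in (A B : Carrier) →
    ¬ IsSquare B →
    (A * B) ^ Q ≡ A * B → ¬ (A * B ≡ 0#) →
    (f₁ f₂ f₃ f₄ g₁ g₂ g₃ g₄ : Carrier → Carrier) →
    Additive f₁ → Additive f₂ → Additive f₃ → Additive f₄ →
    Additive g₁ → Additive g₂ → Additive g₃ → Additive g₄ →
    InAut q r A B (block f₁ f₂ f₃ f₄) (block g₁ g₂ g₃ g₄) →
    IsSemilinearOver p d (block f₁ f₂ f₃ f₄) →
    IsSemilinearOver p e (block g₁ g₂ g₃ g₄) →
    (∀ y → f₂ y ≡ 0#) → (∀ x → f₃ x ≡ 0#) →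
    IsMonomial p f₁ × IsMonomial p f₄ ×
    IsMonomial p g₁ × IsMonomial p g₂ × IsMonomial p g₃ × IsMonomial p g₄
theorem4p9 p h k p-prime p-odd 1≤k k≤ odd-quotient F A B B-nonsquare _ _ f₁ f₂ f₃ f₄ g₁ g₂ g₃ g₄
  f₁-add _ _ f₄-add g₁-add g₂-add g₃-add g₄-add aut _ _ f₂≡0 f₃≡0 =
  Frobenius.Star.monomials p (2 *ℕ h) p-prime p-odd 0<m F k m∤2k m∤4k
    -- The odd number of iterations is o = 2 (o / 2) + 1, and o k is a multiple of m.
    (Frobenius.φ≡-⇒≡0 p (2 *ℕ h) p-prime p-odd 0<m F k (o / 2) (subst (2 *ℕ h ∣_) (o*≡ k) m∣ok))
    {k +ℕ h} {A} {B} m∤2[k+h] (Field.nonsquare⇒≢0 F B-nonsquare)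
    {f₁} {f₂} {f₃} {f₄} {g₁} {g₂} {g₃} {g₄}
    f₁-add f₄-add g₁-add g₂-add g₃-add g₄-add aut f₂≡0 f₃≡0
  where open Exponents h k 1≤k k≤ odd-quotient
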